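{- For all integers $n,d\ge0$, $T(n,\omega^d)\ge P(n,\omega^d)$. Consequently $T(n,\omega^d)=P(n,\omega^d)$.
   Context: $[c]=\{1,\dots,c\}$; ordinals are identified with sets of smaller ordinals; $\approx$ is order-equivalence; $\binom{S}{n}$ is the set of $n$-element subsets. $T(n,S)$ is the least $t\in\mathbb{N}$ such that for every $c\ge1$ and every $\mathrm{COL}:\binom{S}{n}\to[c]$ there is $S'\subseteq S$, $S'\approx S$, with $|\mathrm{COL}(\binom{S'}{n})|\le t$ ($\infty$ if none). Every $\beta<\omega^d\cdot k$ is uniquely $\omega^d b+\sum_{j<d}\omega^j a_j$ with $0\le b<k$, $a_j\in\mathbb{N}$. A coloring rule (CR) on $\binom{\omega^d\cdot k}{n}$ is a pair $(\mathcal{Y},\preceq)$ with $\mathcal{Y}:\{1,\dots,n\}\to\{0,\dots,k-1\}$ and $\preceq$ a total preorder on $I=\{(i,j):1\le i\le n,0\le j<d\}$ (with induced equivalence $\equiv$ and strict part $\prec$) such that: (1) if $d\ge1$, $(i,0)\prec(i',0)$ for $i<i'$; if $d=0$, $\mathcal{Y}(i)<\mathcal{Y}(i')$ for $i<i'$; (2) $(i,j)\equiv(i',j)$ for some $j$ implies $\mathcal{Y}(i)=\mathcal{Y}(i')$; (3) $(i,j)\prec(i,j')$ for $j>j'$; (4) $(i,j)\equiv(i',j')$ implies $j=j'$; (5) for $j>0$, $(i,j)\not\equiv(i',j)$ implies $(i,j-1)\not\equiv(i',j-1)$. $P(n,\omega^d\cdot k)$ is the total number of CRs on $\binom{\omega^d\cdot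 k}{n}$, and $P(n,\omega^d)=P(n,\omega^d\cdot 1)$. -}

module Defs where

open import Level using (0ℓ)
open import Data.Bool using (Bool; true; false; T)
open import Data.Bool.Properties using (T?)
open import Data.Fin using (Fin; toℕ)
import Data.Fin as Fin
import Data.Fin.Properties as Fin
open import Data.Fin.Subset using (Subset; _∈_; ∣_∣)
open import Data.List using (List; []; _∷_; allFin; cartesianProduct; cartesianProductWith; filter; length)
open import Data.Nat using (ℕ; zero; suc; _≤_; _≥_)
import Data.Nat as ℕ
import Data.Nat.Properties as ℕ
open import Data.Product using (Σ; Σ-syntax; ∃-syntax; _×_; _,_; proj₁)
open import Data.Product.Relation.Binary.Lex.Strict using (×-strictTotalOrder)
open import Data.Vec using (Vec; []; _∷_; lookup)
open import Data.Vec.Relation.Binary.Pointwise.Inductive using (Pointwise)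
import Data.Vec.Relation.Binary.Pointwise.Inductive as Pointwise
open import Data.Vec.Relation.Unary.All using (All)
open import Data.Vec.Relation.Unary.AllPairs using (AllPairs)
open import Function using (_on_)
open import Function.Bundles using (Func; _⇔_)
open import Relation.Binary using (Rel; Setoid; StrictTotalOrder; IsTotalPreorder; Decidable; _Respects_)
import Relation.Binary.Construct.Add.Supremum.NonStrict as Supremum
import Relation.Binary.Construct.On as On
open import Relation.Binary.Morphism.Structures using (IsOrderIsomorphism)
open import Relation.Binary.PropositionalEquality using (_≡_; refl)
import Relation.Binary.PropositionalEquality as ≡
open import Relation.Nullary using (¬_; Dec; _×-dec_; _⊎-dec_; _→-dec_; ¬?)
open import Relation.Nullary.Construct.Add.Supremum using (_⁺; [_]; ⊤⁺)
open import Relation.Nullary.Decidable using (map′)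
open import Relation.Unary using (Pred)

------------------------------------------------------------------------
-- Ordinals, as linear orders

LinearOrder : Set₁
LinearOrder = StrictTotalOrder 0ℓ 0ℓ 0ℓ

-- The product in `×-strictTotalOrder` compares first components first,
-- whereas in the ordinal product α · β (β copies of α) the β-coordinate
-- is the most significant one.
infixl 7 _·_

_·_ : LinearOrder → LinearOrder → LinearOrder
α · β = ×-strictTotalOrder β α

ω : LinearOrder
ω = ℕ.<-strictTotalOrder

infix 8 ω^_

ω^_ : ℕ → LinearOrder
ω^ zero      = Fin.<-strictTotalOrder 1
ω^ (suc d) = ω^ d · ω

------------------------------------------------------------------------
-- The big Ramsey degree T(n,S)

ℕ∞ : Set
ℕ∞ = ℕ ⁺

open Supremum _≤_ public using () renaming (_≤⁺_ to _≤∞_)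

module _ (S : LinearOrder) where
  open StrictTotalOrder S using (Carrier; _≈_; _<_; module Eq)

  -- An n-element subset is listed in increasing order.
  record FinSubset (n : ℕ) : Set where
    constructor finSubset
    field
      elements   : Vec Carrier n
      increasing : AllPairs _<_ elements

  open FinSubset

  binom : ℕ → Setoid 0ℓ 0ℓ
  binom n = record
    { Carrier       = FinSubset n
    ; _≈_           = Pointwise _≈_ on elements
    ; isEquivalence = On.isEquivalence elements (Setoid.isEquivalence (Pointwise.setoid Eq.setoid n))
    }

  Coloring : (n c : ℕ) → Set
  Coloring n c = Func (binom n) (≡.setoid (Fin c))

  OrderEquivalent : Pred Carrier 0ℓ → Set
  OrderEquivalent S′ =
    Σ[ f ∈ (Carrier → Σ Carrier S′) ]
      IsOrderIsomorphism _≈_ (_≈_ on proj₁) _<_ (_<_ on proj₁) f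

  -- C = COL(binom S′ n)
  IsColorSet : ∀ {n c} → Coloring n c → Pred Carrier 0ℓ → Subset c → Set
  IsColorSet {n} COL S′ C =
    ∀ x → x ∈ C ⇔ (∃[ A ] (All S′ (elements {n} A) × Func.to COL A ≡ x))

  RamseyBound : (n t : ℕ) → Set₁
  RamseyBound n t =
    (c : ℕ) → c ≥ 1 → (COL : Coloring n c) →
    Σ[ S′ ∈ Pred Carrier 0ℓ ]
      S′ Respects _≈_ × OrderEquivalent S′ ×
      (Σ[ C ∈ Subset c ] IsColorSet COL S′ C × ∣ C ∣ ≤ t)

-- The graph of the function T:  T[ n , S ]≔ τ  says that T(n,S) = τ.
infix 4 T[_,_]≔_

T[_,_]≔_ : ℕ → LinearOrder → ℕ∞ → Set₁
T[ n , S ]≔ [ t ] = RamseyBound S n t × (∀ t′ → RamseyBound S n t′ → t ≤ t′)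
T[ n , S ]≔ ⊤⁺    = ∀ t → ¬ RamseyBound S n t

------------------------------------------------------------------------
-- Coloring rules

Index : ℕ → ℕ → Set
Index n d = Fin n × Fin d

-- The indices 1 ≤ i ≤ n are shifted to 0 ≤ i < n.
module _ {n d k : ℕ} (Y : Fin n → Fin k) (_⪯_ : Rel (Index n d) 0ℓ) where

  private
    _≋_ : Rel (Index n d) 0ℓ
    p ≋ q = p ⪯ q × q ⪯ p

    _≺_ : Rel (Index n d) 0ℓ
    p ≺ q = p ⪯ q × ¬ (q ⪯ p)

  record IsColoringRule : Set where
    field
      isTotalPreorder : IsTotalPreorder _≡_ _⪯_
      rule1   : ∀ i i′ j → i Fin.< i′ → toℕ j ≡ 0 → (i , j) ≺ (i′ , j)
      rule1-0 : d ≡ 0 → ∀ i i′ → i Fin.< i′ → Y i Fin.< Y i′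
      rule2   : ∀ i i′ j → (i , j) ≋ (i′ , j) → Y i ≡ Y i′
      rule3   : ∀ i j j′ → j Fin.> j′ → (i , j) ≺ (i , j′)
      rule4   : ∀ i i′ j j′ → (i , j) ≋ (i′ , j′) → j ≡ j′
      rule5   : ∀ i i′ j j⁻ → toℕ j ≡ suc (toℕ j⁻) →
                ¬ ((i , j) ≋ (i′ , j)) → ¬ ((i , j⁻) ≋ (i′ , j⁻))

  module _ (_⪯?_ : Decidable _⪯_) where

    private
      _≋?_ : Decidable _≋_
      p ≋? q = (p ⪯? q) ×-dec (q ⪯? p)

      _≺?_ : Decidable _≺_
      p ≺? q = (p ⪯? q) ×-dec ¬? (q ⪯? p)

      all-index? : {P : Pred (Index n d) 0ℓ} → (∀ p → Dec (P p)) → Dec (∀ p → P p)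
      all-index? P? = map′ (λ h (i , j) → h i j) (λ h i j → h (i , j))
        (Fin.all? λ i → Fin.all? λ j → P? (i , j))

      isTotalPreorder? : Dec (IsTotalPreorder _≡_ _⪯_)
      isTotalPreorder? = map′
        (λ (r , t , c) → record
          { isPreorder = record
            { isEquivalence = ≡.isEquivalence
            ; reflexive     = λ { {x} refl → r x }
            ; trans         = λ {x} {y} {z} → t x y z
            }
          ; total = c
          })
        (λ h → let open IsTotalPreorder h using (reflexive; trans; total) in
          (λ x → reflexive refl) , (λ x y z → trans) , total)
        ( (all-index? λ x → x ⪯? x)
          ×-dec (all-index? λ x → all-index? λ y → all-index? λ z →
                   (x ⪯? y) →-dec ((y ⪯? z) →-dec (x ⪯? z)))
          ×-dec (all-index? λ x → all-index? λ y → (x ⪯? y) ⊎-dec (y ⪯? x)))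

    isColoringRule? : Dec IsColoringRule
    isColoringRule? = map′
      (λ (p , r1 , r10 , r2 , r3 , r4 , r5) → record
        { isTotalPreorder = p ; rule1 = r1 ; rule1-0 = r10
        ; rule2 = r2 ; rule3 = r3 ; rule4 = r4 ; rule5 = r5 })
      (λ h → let open IsColoringRule h in
        isTotalPreorder , rule1 , rule1-0 , rule2 , rule3 , rule4 , rule5)
      ( isTotalPreorder?
        ×-dec (Fin.all? λ i → Fin.all? λ i′ → Fin.all? λ j →
                 (i Fin.<? i′) →-dec ((toℕ j ℕ.≟ 0) →-dec ((i , j) ≺? (i′ , j))))
        ×-dec ((d ℕ.≟ 0) →-dec (Fin.all? λ i → Fin.all? λ i′ →
                 (i Fin.<? i′) →-dec (Y i Fin.<? Y i′)))
        ×-dec (Fin.all? λ i → Fin.all? λ i′ → Fin.all? λ j →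
                 ((i , j) ≋? (i′ , j)) →-dec (Y i Fin.≟ Y i′))
        ×-dec (Fin.all? λ i → Fin.all? λ j → Fin.all? λ j′ →
                 (j′ Fin.<? j) →-dec ((i , j) ≺? (i , j′)))
        ×-dec (Fin.all? λ i → Fin.all? λ i′ → Fin.all? λ j → Fin.all? λ j′ →
                 ((i , j) ≋? (i′ , j′)) →-dec (j Fin.≟ j′))
        ×-dec (Fin.all? λ i → Fin.all? λ i′ → Fin.all? λ j → Fin.all? λ j⁻ →
                 (toℕ j ℕ.≟ suc (toℕ j⁻)) →-dec
                   (¬? ((i , j) ≋? (i′ , j)) →-dec ¬? ((i , j⁻) ≋? (i′ , j⁻)))))

-- For counting, the function Y and the relation ⪯ are given by their
-- tables of values, so that distinct pairs are distinct as data.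
Table : ℕ → ℕ → Set
Table n d = Vec (Vec (Vec (Vec Bool d) n) d) n

entry : ∀ {n d} → Table n d → Index n d → Index n d → Bool
entry R (i , j) (i′ , j′) = lookup (lookup (lookup (lookup R i) j) i′) j′

IsCR : (n d k : ℕ) → Pred (Vec (Fin k) n × Table n d) 0ℓ
IsCR n d k (Y , R) = IsColoringRule (lookup Y) (λ p q → T (entry R p q))

isCR? : (n d k : ℕ) → ∀ YR → Dec (IsCR n d k YR)
isCR? n d k (Y , R) = isColoringRule? (lookup Y) (λ p q → T (entry R p q)) (λ p q → T? (entry R p q))

-- If xs lists every element of A exactly once, then vectors n xs lists
-- every element of Vec A n exactly once.
vectors : {A : Set} (n : ℕ) → List A → List (Vec A n)
vectors zero      xs = [] ∷ []
vectors (suc n) xs = cartesianProductWith _∷_ xs (vectors n xs)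

tables : (n d : ℕ) → List (Table n d)
tables n d = vectors n (vectors d (vectors n (vectors d (false ∷ true ∷ []))))

-- P(n , ω^d · k)
P : (n d k : ℕ) → ℕ
P n d k = length (filter (isCR? n d k) (cartesianProduct (vectors n (allFin k)) (tables n d)))

{-# OPTIONS --safe #-}

-- Top digit first, an element of ω^d is a branch of the tree ω^{≤d}, and a coloring
-- rule is the order type of the labels on n branches of a tree whose labels increase
-- along branches and are distinct at distinct nodes.
--
-- Upper bound: encode relabels ω^d by such a tree, and infinite Ramsey, applied once per
-- rule to the color of the set of that rule with labels drawn from H ⊆ ω, gives one H on
-- which each rule has a single color. The encoded copy of ω^d with labels in H meets
-- only the colors of the rules.
--
-- Lower bound: color a set by the rule it satisfies. If S′ has order type ω^d, then
-- at infinitely many columns it has order type ω^(d-1), recursively; so the labels of a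
-- pattern satisfying a given rule can be chosen in increasing order, each above all
-- previous ones, inside S′.
module Submission where

open import Defs
open import Axiom.ExcludedMiddle using (ExcludedMiddle)
open import Data.Bool using (Bool; true; false; T)
open import Data.Bool.Properties using (T?)
open import Data.Fin as Fin using (Fin; zero; suc; toℕ; inject₁; fromℕ; opposite)
import Data.Fin.Properties as Fin
open import Data.Fin.Subset as Subset using (Subset; inside; outside; ∣_∣; _∪_; ⁅_⁆; ⊤; ⊥)
import Data.Fin.Subset.Properties as Subset
open import Data.List as List using (List; []; _∷_; length; filter; allFin; cartesianProduct)
open import Data.List.Membership.Propositional using () renaming (_∈_ to _∈ₗ_)
import Data.List.Membership.Propositional.Properties as List
import Data.List.Properties as List
import Data.List.Relation.Unary.All as ListAll
import Data.List.Relation.Unary.AllPairs as ListAllPairs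
import Data.List.Relation.Unary.Any as ListAny
import Data.List.Relation.Unary.Any.Properties as ListAny
open import Data.List.Relation.Unary.Unique.Propositional using (Unique)
import Data.List.Relation.Unary.Unique.Propositional.Properties as Unique
open import Data.Nat using (ℕ; zero; suc; pred; _+_; _*_; _∸_; _⊔_; _≤_; _<_; _≤′_; ≤′-refl; ≤′-step; _≤ᵇ_; _<?_)
open import Data.Nat using (z≤n; s≤s; s≤s⁻¹; z<s; s<s)
open import Data.Nat.Induction using (<-wellFounded)
open import Data.Nat.Properties as ℕ
open import Data.Product using (Σ; ∃; ∃-syntax; _×_; _,_; proj₁; proj₂)
open import Data.Product.Relation.Binary.Lex.Strict using (×-wellFounded)
open import Data.Sum using (_⊎_; inj₁; inj₂; [_,_]′)
open import Data.Vec as Vec using (Vec; []; _∷_; lookup; tabulate)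
open import Data.Vec.Membership.Propositional using (_∈_)
import Data.Vec.Membership.Propositional.Properties as Vec∈
import Data.Vec.Properties as Vec
import Data.Vec.Relation.Binary.Pointwise.Inductive as Pointwise
open import Data.Vec.Relation.Unary.All as All using (All; []; _∷_)
import Data.Vec.Relation.Unary.All.Properties as All
open import Data.Vec.Relation.Unary.AllPairs as AllPairs using (AllPairs; []; _∷_)
import Data.Vec.Relation.Unary.AllPairs.Properties as AllPairs
open import Data.Vec.Relation.Unary.Any as Any using (here; there)
import Data.Vec.Relation.Unary.Any.Properties as Any
open import Function using (_∘_; id)
open import Function.Bundles using (Func; Equivalence; mk⇔)
open import Induction.WellFounded using (WellFounded; Acc; acc)
open import Level using (0ℓ)
open import Relation.Binary using (Rel; StrictTotalOrder; tri<; tri≈; tri>; IsTotalPreorder)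
import Relation.Binary.Construct.Add.Supremum.NonStrict as Supremum
import Relation.Binary.Construct.On as On
open import Relation.Binary.Morphism.Structures using (IsOrderIsomorphism)
open import Relation.Binary.PropositionalEquality
open import Relation.Nullary using (¬_; Dec; yes; no; does; contradiction; ¬?; _×-dec_)
open import Relation.Nullary.Construct.Add.Supremum using ([_]; ⊤⁺)
open import Relation.Nullary.Decidable using (decidable-stable)
open import Relation.Unary using (Pred; Decidable)

-- The infinite Ramsey theorem

record Increasing : Set where
  constructor incr
  field
    at   : ℕ → ℕ
    mono : ∀ {m n} → m < n → at m < at n

  mono-≤ : ∀ {m n} → m ≤ n → at m ≤ at n
  mono-≤ m≤n with m≤n⇒m<n∨m≡n m≤n
  ... | inj₁ m<n = <⇒≤ (mono m<n)
  ... | inj₂ m≡n = ≤-reflexive (cong at m≡n)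

  cancel-≤ : ∀ {m n} → at m ≤ at n → m ≤ n
  cancel-≤ le = ≮⇒≥ λ n<m → ≤⇒≯ le (mono n<m)

  at-injective : ∀ {m n} → at m ≡ at n → m ≡ n
  at-injective eq = ≤-antisym (cancel-≤ (≤-reflexive eq)) (cancel-≤ (≤-reflexive (sym eq)))

open Increasing

fromSteps : (f : ℕ → ℕ) → (∀ m → f m < f (suc m)) → Increasing
fromSteps f step = incr f λ m<n → go (≤⇒≤′ m<n)
  where
  go : ∀ {m n} → suc m ≤′ n → f m < f n
  go ≤′-refl        = step _
  go (≤′-step m<′n) = <-trans (go m<′n) (step _)

idᵢ : Increasing
idᵢ = incr id id

infixr 9 _∘ᵢ_

_∘ᵢ_ : Increasing → Increasing → Increasing
f ∘ᵢ g = incr (at f ∘ at g) (mono f ∘ mono g)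

sucᵢ : Increasing
sucᵢ = incr suc s<s

-- `h ∘ᵢ lift f` keeps the least point of the set enumerated by `h` and selects the others from its
-- tail, as the induction in `ramsey` requires.
lift : Increasing → Increasing
lift f = fromSteps f′ f′-step
  where
  f′ : ℕ → ℕ
  f′ zero    = zero
  f′ (suc m) = suc (at f m)
  f′-step : ∀ m → f′ m < f′ (suc m)
  f′-step zero    = z<s
  f′-step (suc m) = s<s (mono f (n<1+n m))

bound : ∀ {c} (f : Fin c → ℕ) → ∃[ M ] ∀ i → f i ≤ M
bound {zero}  f = 0 , λ ()
bound {suc c} f with bound (f ∘ suc)
... | M , f≤M = f zero ⊔ M , λ
  { zero    → m≤m⊔n (f zero) M
  ; (suc i) → ≤-trans (f≤M i) (m≤n⊔m (f zero) M) }

InfinitelyOften : (ℕ → Set) → Set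
InfinitelyOften Q = ∀ N → ∃[ m ] N ≤ m × Q m

enumerate : ∀ {Q} → InfinitelyOften Q → ∃[ s ] ∀ m → Q (at s m)
enumerate {Q} io = fromSteps (proj₁ ∘ s) (λ m → proj₁ (proj₂ (io (suc (proj₁ (s m)))))) , proj₂ ∘ s
  where
  s : ℕ → Σ ℕ Q
  s zero    with io 0
  ... | m , _ , q = m , q
  s (suc i) = let m , _ , q = io (suc (proj₁ (s i))) in m , q

-- An infinite set is given by its enumeration, so a coloring of p-element sets becomes a coloring
-- of enumerations that reads only their first `p` values.
Local : ∀ {A : Set} → ℕ → (Increasing → A) → Set
Local p χ = ∀ L L′ → (∀ i → i < p → at L i ≡ at L′ i) → χ L ≡ χ L′

module _ (em : ExcludedMiddle 0ℓ) where

  pigeonhole : ∀ {c} (k : ℕ → Fin c) → ∃[ κ ] InfinitelyOften (λ m → k m ≡ κ)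
  pigeonhole {c} k with em {∃[ κ ] InfinitelyOften (λ m → k m ≡ κ)}
  ... | yes found = found
  -- `M` is beyond every threshold, so the color `k M` should have been avoided at `M` itself.
  ... | no ¬found = contradiction refl (proj₂ (eventually-avoided (k M)) M (N≤M (k M)))
    where
    eventually-avoided : ∀ κ → ∃[ N ] ∀ m → N ≤ m → k m ≢ κ
    eventually-avoided κ with em {∃[ N ] ∀ m → N ≤ m → k m ≢ κ}
    ... | yes avoided = avoided
    ... | no ¬avoided = contradiction (κ , often) ¬found
      where
      often : InfinitelyOften (λ m → k m ≡ κ)
      often N with em {∃[ m ] N ≤ m × k m ≡ κ}
      ... | yes hit = hit
      ... | no ¬hit = contradiction (N , λ m N≤m eq → ¬hit (m , N≤m , eq)) ¬avoided
    M : ℕ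
    M = proj₁ (bound (proj₁ ∘ eventually-avoided))
    N≤M : ∀ κ → proj₁ (eventually-avoided κ) ≤ M
    N≤M = proj₂ (bound (proj₁ ∘ eventually-avoided))

  Homogeneous : ∀ {c} → (Increasing → Fin c) → Increasing → Set
  Homogeneous χ h = ∃[ k ] ∀ L → χ (h ∘ᵢ L) ≡ k

  -- The sets X₀ ⊇ X₁ ⊇ … of the
  -- usual proof are enumerated by hs 0 , hs 1 , … : the color of any set
  -- consisting of min Xᵢ and p points of Xᵢ₊₁ is k i.
  ramsey : ∀ p {c} (χ : Increasing → Fin c) → Local p χ → ∃ (Homogeneous χ)
  ramsey zero    χ loc = idᵢ , χ idᵢ , λ L → loc _ _ λ _ ()
  ramsey (suc p) {c} χ loc = H ∘ᵢ s , κ , λ L → trans (homogeneous (s ∘ᵢ L)) (s-κ (at L 0))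
    where
    χ⁺ : Increasing → Increasing → Fin c
    χ⁺ h L = χ (h ∘ᵢ lift L)
    χ⁺-local : ∀ h → Local p (χ⁺ h)
    χ⁺-local h L L′ eq = loc _ _ λ
      { zero    _         → refl
      ; (suc i) (s≤s i<p) → cong (at h ∘ suc) (eq i i<p) }
    thin : ∀ h → ∃ (Homogeneous (χ⁺ h))
    thin h = ramsey p (χ⁺ h) (χ⁺-local h)
    hs : ℕ → Increasing
    hs zero    = idᵢ
    hs (suc i) = hs i ∘ᵢ sucᵢ ∘ᵢ proj₁ (thin (hs i))
    k : ℕ → Fin c
    k i = proj₁ (proj₂ (thin (hs i)))
    H : Increasing
    H = fromSteps (λ i → at (hs i) 0) λ i → mono (hs i) z<s
    rest : ℕ → ℕ → Increasing
    rest i zero    = idᵢ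
    rest i (suc m) = rest i m ∘ᵢ sucᵢ ∘ᵢ proj₁ (thin (hs (m + i)))
    hs-rest : ∀ i m x → at (hs (m + i)) x ≡ at (hs i) (at (rest i m) x)
    hs-rest i zero    x = refl
    hs-rest i (suc m) x = hs-rest i m _
    homogeneous : ∀ L → χ (H ∘ᵢ L) ≡ k (at L 0)
    homogeneous L = trans (loc _ _ λ m _ → agree m) (proj₂ (proj₂ (thin (hs i))) (minima ∘ᵢ gaps))
      where
      i = at L 0
      -- Seen from `hs (suc i)`, `minima` enumerates the least points of all later sets, and `gaps`
      -- picks out those that `L` uses.
      minima : Increasing
      minima = fromSteps (λ m → at (rest (suc i) m) 0) λ m → mono (rest (suc i) m) z<s
      i<L : ∀ m → i < at L (suc m)
      i<L m = mono L z<s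
      gaps : Increasing
      gaps = incr (λ m → at L (suc m) ∸ suc i) λ {m} m<n → ∸-monoˡ-< (mono L (s<s m<n)) (i<L m)
      agree : ∀ m → at (H ∘ᵢ L) m ≡ at (hs i ∘ᵢ lift (proj₁ (thin (hs i)) ∘ᵢ minima ∘ᵢ gaps)) m
      agree zero    = refl
      agree (suc m) = trans (cong (at H) (sym (m∸n+n≡m (i<L m)))) (hs-rest (suc i) (at gaps m) 0)
    -- By now a color depends only on the least index; passing to infinitely many indices with the
    -- same `k` makes it constant.
    κ = proj₁ (pigeonhole k)
    s = proj₁ (enumerate (proj₂ (pigeonhole k)))
    s-κ = proj₂ (enumerate (proj₂ (pigeonhole k)))

  -- Homogeneity passes to subsets, so the colorings are handled one at a time, each inside the set
  -- found for the previous ones.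
  ramsey* : ∀ {c} p t (χ : Fin t → Increasing → Fin c) → (∀ i → Local p (χ i)) →
            ∃[ h ] ∀ i → Homogeneous (χ i) h
  ramsey* p zero    χ loc = idᵢ , λ ()
  ramsey* p (suc t) χ loc =
    let h₀ , k₀ , hom₀ = ramsey p (χ zero) (loc zero)
        h  , hom       = ramsey* p t (λ i L → χ (suc i) (h₀ ∘ᵢ L))
                           (λ i L L′ eq → loc (suc i) _ _ λ j j<p → cong (at h₀) (eq j j<p))
    in h₀ ∘ᵢ h , λ { zero → k₀ , λ L → hom₀ (h ∘ᵢ L) ; (suc i) → hom i }

  -- Between the prescribed points r p, L grows by unit steps; the gaps of the
  -- prescribed values leave enough room for this.
  interpolate : ∀ {X : Set} (r v w : X → ℕ) N →
    (∀ x → r x ≤ N) → (∀ x → v x ≡ suc N * suc (w x)) →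
    (∀ x y → r x ≤ r y → v x ≤ v y) → (∀ x y → v x ≤ v y → r x ≤ r y) →
    ∃[ L ] ∀ x → at L (r x) ≡ v x
  interpolate {X} r v w N r≤N v≡ r⇒v v⇒r = fromSteps L L-step , L-r
    where
    hit : ∀ m → Dec (∃[ x ] r x ≡ m)
    hit m = em
    L : ℕ → ℕ
    L m with hit m
    L m       | yes (x , _) = v x
    -- Starting from 0 is safe: every prescribed value is at least `suc N`.
    L zero    | no  _       = 0
    L (suc m) | no  _       = suc (L m)
    L-r : ∀ x → L (r x) ≡ v x
    L-r x with hit (r x)
    ... | yes (y , eq) = ≤-antisym (r⇒v y x (≤-reflexive eq)) (r⇒v x y (≤-reflexive (sym eq)))
    ... | no ¬hit      = contradiction (x , refl) ¬hit
    v-gap : ∀ x y → r x < r y → v x + N < v y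
    v-gap x y lt with ≤-<-connex (v y) (v x)
    ... | inj₁ le = contradiction lt (≤⇒≯ (v⇒r y x le))
    ... | inj₂ v< = begin-strict
      v x + N                    <⟨ +-monoʳ-< (v x) (n<1+n N) ⟩
      v x + suc N                ≡⟨ +-comm (v x) (suc N) ⟩
      suc N + v x                ≡⟨ cong (suc N +_) (v≡ x) ⟩
      suc N + suc N * suc (w x)  ≡⟨ *-suc (suc N) (suc (w x)) ⟨
      suc N * suc (suc (w x))    ≤⟨ *-monoʳ-≤ (suc N) (*-cancelˡ-< (suc N) _ _ (subst₂ _<_ (v≡ x) (v≡ y) v<)) ⟩
      suc N * suc (w y)          ≡⟨ v≡ y ⟨
      v y                        ∎
      where open ℕ.≤-Reasoning
    -- In other words L m + (N - m) < v y: the unit steps that remain up to r y ≤ N cannot overtake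
    -- `v y`.
    room : ∀ m y → m < r y → L m + N < v y + m
    room m y m<r with hit m
    room m y m<r | yes (x , refl) = <-≤-trans (v-gap x y m<r) (m≤m+n (v y) m)
    room zero y m<r | no _ = begin-strict
      N                  <⟨ n<1+n N ⟩
      suc N              ≤⟨ m≤m*n (suc N) (suc (w y)) ⟩
      suc N * suc (w y)  ≡⟨ v≡ y ⟨
      v y                ≡⟨ +-identityʳ (v y) ⟨
      v y + 0            ∎
      where open ℕ.≤-Reasoning
    room (suc m) y m<r | no _ = subst (suc (L m + N) <_) (sym (+-suc (v y) m)) (s<s (room m y (<-trans (n<1+n m) m<r)))
    L-step : ∀ m → L m < L (suc m)
    L-step m with hit (suc m)
    ... | no _           = n<1+n (L m)
    ... | yes (y , r≡)   = +-cancelʳ-< N (L m) (v y)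
      (<-≤-trans (room m y (≤-reflexive (sym r≡))) (+-monoʳ-≤ (v y) (<⇒≤ (subst (_≤ N) r≡ (r≤N y)))))

-- ω^d as the set of branches of a tree

Ord : ℕ → Set
Ord d = StrictTotalOrder.Carrier (ω^ d)

Lt : ∀ d → Ord d → Ord d → Set
Lt d = StrictTotalOrder._<_ (ω^ d)

≈⇒≡ : ∀ d {x y : Ord d} → StrictTotalOrder._≈_ (ω^ d) x y → x ≡ y
≈⇒≡ zero    eq           = eq
≈⇒≡ (suc d) (refl , eq) = cong (_ ,_) (≈⇒≡ d eq)

Lt-irrefl : ∀ d {x} → ¬ Lt d x x
Lt-irrefl d = StrictTotalOrder.irrefl (ω^ d) (StrictTotalOrder.Eq.refl (ω^ d))

Lt-wellFounded : ∀ d → WellFounded (Lt d)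
Lt-wellFounded zero zero = acc λ { {zero} () }
Lt-wellFounded (suc d) = ×-wellFounded <-wellFounded (Lt-wellFounded d)

head-≤ : ∀ d {x y} → Lt (suc d) x y → proj₁ x ≤ proj₁ y
head-≤ d (inj₁ a<b)        = <⇒≤ a<b
head-≤ d (inj₂ (refl , _)) = ≤-refl

tail-< : ∀ d {x y} → Lt (suc d) x y → proj₁ x ≡ proj₁ y → Lt d (proj₂ x) (proj₂ y)
tail-< d (inj₁ a<b)       a≡b = contradiction a≡b (<⇒≢ a<b)
tail-< d (inj₂ (_ , x<y)) _   = x<y

-- The digits are indexed from the most significant one: digit k of x ∈ ω^d is
-- the coefficient of ω^(d-1-k).
digit : ∀ d → Ord d → Fin d → ℕ
digit (suc d) (a , x) zero    = a
digit (suc d) (a , x) (suc k) = digit d x k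

fromDigits : ∀ d → (Fin d → ℕ) → Ord d
fromDigits zero    f = zero
fromDigits (suc d) f = f zero , fromDigits d (f ∘ suc)

digit-fromDigits : ∀ d f k → digit d (fromDigits d f) k ≡ f k
digit-fromDigits (suc d) f zero    = refl
digit-fromDigits (suc d) f (suc k) = digit-fromDigits d (f ∘ suc) k

digit-injective : ∀ d {x y} → (∀ k → digit d x k ≡ digit d y k) → x ≡ y
digit-injective zero    {zero} {zero} eq = refl
digit-injective (suc d) eq = cong₂ _,_ (eq zero) (digit-injective d (eq ∘ suc))

mapω : ∀ d → (ℕ → ℕ) → Ord d → Ord d
mapω zero    f x       = x
mapω (suc d) f (a , x) = f a , mapω d f x

digit-mapω : ∀ d f x k → digit d (mapω d f x) k ≡ f (digit d x k)
digit-mapω (suc d) f (a , x) zero    = refl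
digit-mapω (suc d) f (a , x) (suc k) = digit-mapω d f x k

mapω-∘ : ∀ d f g x → mapω d f (mapω d g x) ≡ mapω d (f ∘ g) x
mapω-∘ zero    f g x       = refl
mapω-∘ (suc d) f g (a , x) = cong (_ ,_) (mapω-∘ d f g x)

mapω-mono : ∀ d L {x y} → Lt d x y → Lt d (mapω d (at L) x) (mapω d (at L) y)
mapω-mono zero    L x<y                 = x<y
mapω-mono (suc d) L (inj₁ a<b)          = inj₁ (mono L a<b)
mapω-mono (suc d) L (inj₂ (refl , x<y)) = inj₂ (refl , mapω-mono d L x<y)

-- Rule (3) for the digits: going down a branch, towards smaller exponents of ω, the labels grow.
Descending : ∀ d → Ord d → Set
Descending d x = ∀ k k′ → k Fin.< k′ → digit d x k < digit d x k′

-- Rules (4) and (5) for the digits, the latter iterated up to the root: a label belongs to a single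
-- node of the tree.
Coherent : ∀ d → Ord d → Ord d → Set
Coherent d x y = ∀ k k′ → digit d x k ≡ digit d y k′ →
                 k ≡ k′ × (∀ l → l Fin.≤ k → digit d x l ≡ digit d y l)

-- Embedding patterns into large sets

Large : ∀ d → (Ord d → Set) → Set
Large zero    S = S zero
Large (suc d) S = ∀ N → ∃[ b ] N ≤ b × Large d (λ x → S (b , x))

-- L maps the digits of x below v to a node above which S is still large, so that the
-- images of the digits ≥ v can be chosen later.
Extendable : ∀ d → (Ord d → Set) → (ℕ → ℕ) → ℕ → Ord d → Set
Extendable zero    S L v x       = S x
Extendable (suc d) S L v (a , x) =
  (a < v × Extendable d (λ y → S (L a , y)) L v x) ⊎ (v ≤ a × Large (suc d) S)

extendable-start : ∀ d {S L v} y → Large d S → (∀ k → v ≤ digit d y k) → Extendable d S L v y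
extendable-start zero    zero    large _  = large
extendable-start (suc d) (a , y) large v≤ = inj₂ (v≤ zero , large)

extendable-finish : ∀ d {S L v} y → (∀ k → digit d y k < v) → Extendable d S L v y → S (mapω d L y)
extendable-finish zero    y       _  s                = s
extendable-finish (suc d) (a , y) <v (inj₁ (_ , g))   = extendable-finish d y (<v ∘ suc) g
extendable-finish (suc d) (a , y) <v (inj₂ (v≤a , _)) = contradiction (<v zero) (≤⇒≯ v≤a)

module _ {L L′ : ℕ → ℕ} {v : ℕ} (agree : ∀ m → m < v → L′ m ≡ L m) where

  extendable-descend : ∀ d {S a} y → a < v → Extendable d (λ z → S (L a , z)) L′ (suc v) y →
                 Extendable (suc d) S L′ (suc v) (a , y)
  extendable-descend d {S} {a} y a<v g = inj₁ (m<n⇒m<1+n a<v ,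
    subst (λ c → Extendable d (λ z → S (c , z)) L′ (suc v) y) (sym (agree a a<v)) g)

  extendable-skip : ∀ d {S} y → (∀ k → digit d y k ≢ v) →
              Extendable d S L v y → Extendable d S L′ (suc v) y
  extendable-skip zero    y       _  s                    = s
  extendable-skip (suc d) (a , y) ≢v (inj₁ (a<v , g))     =
    extendable-descend d y a<v (extendable-skip d y (≢v ∘ suc) g)
  extendable-skip (suc d) (a , y) ≢v (inj₂ (v≤a , large)) =
    inj₂ (≤∧≢⇒< v≤a (≢v zero ∘ sym) , large)

  -- The digits after the leading `v` exceed `v`, so none of them has been placed yet, and largeness
  -- above the chosen node is all that is required.
  extendable-hit : ∀ d {S} y → Descending (suc d) (v , y) → Large d (λ z → S (L′ v , z)) →
             Extendable (suc d) S L′ (suc v) (v , y)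
  extendable-hit d y desc large =
    inj₁ (n<1+n v , extendable-start d y large λ k → desc zero (suc k) z<s)

-- All elements containing the digit v do so at the same node of the tree, so one
-- value b serves as the image of v for all of them.
extendable-step : ∀ d {S L v} x k → Descending d x → digit d x k ≡ v → Extendable d S L v x →
  ∃[ b ] L v ≤ b × (∀ {L′} → (∀ m → m < v → L′ m ≡ L m) → L′ v ≡ b →
    ∀ y → Descending d y → (∀ k′ → v ≡ digit d y k′ → k ≡ k′ × (∀ l → l Fin.≤ k → digit d x l ≡ digit d y l)) →
    Extendable d S L v y → Extendable d S L′ (suc v) y)
extendable-step (suc d) (a , x) zero desc refl (inj₁ (a<a , _)) = contradiction a<a (n≮n a)
extendable-step (suc d) {S} {L} {v} (a , x) zero desc refl (inj₂ (_ , large)) =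
  let b , Lv≤b , large′ = large (L v) in b , Lv≤b , λ agree L′v≡b → λ
  -- Here `v` labels a node of the top level, so coherence keeps it away from the deeper levels of
  -- `y`.
  { (a′ , y) desc-y coh (inj₁ (a′<v , g)) → extendable-descend agree d y a′<v
      (extendable-skip agree d y (λ k eq → Fin.0≢1+n (proj₁ (coh (suc k) (sym eq)))) g)
  ; (a′ , y) desc-y coh (inj₂ (v≤a′ , _)) → at-or-after agree L′v≡b large′ desc-y (m≤n⇒m<n∨m≡n v≤a′) }
  where
  at-or-after : ∀ {b L′ a′ y} → (∀ m → m < v → L′ m ≡ L m) → L′ v ≡ b → Large d (λ z → S (b , z)) →
    Descending (suc d) (a′ , y) → v < a′ ⊎ v ≡ a′ → Extendable (suc d) S L′ (suc v) (a′ , y)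
  at-or-after _     _     _      _      (inj₁ v<a′) = inj₂ (v<a′ , large)
  at-or-after {y = y} agree refl large′ desc-y (inj₂ refl) = extendable-hit agree d y desc-y large′
extendable-step (suc d) (a , x) (suc k) desc eq (inj₂ (v≤a , _)) =
  contradiction (subst (a <_) eq (desc zero (suc k) z<s)) (≤⇒≯ v≤a)
extendable-step (suc d) {S} {L} {v} (a , x) (suc k) desc eq (inj₁ (a<v , g)) =
  let b , Lv≤b , step = extendable-step d x k (λ l l′ lt → desc (suc l) (suc l′) (s<s lt)) eq g
  in b , Lv≤b , λ {L′} agree L′v≡b → λ
  { (a′ , y) desc-y coh (inj₂ (v≤a′ , large)) →
      inj₂ (≤∧≢⇒< v≤a′ (λ v≡a′ → Fin.0≢1+n (sym (proj₁ (coh zero v≡a′)))) , large)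
  ; (a′ , y) desc-y coh (inj₁ (a′<v , g′)) → extendable-descend agree d y a′<v
      (same-or-other agree desc-y coh (step agree L′v≡b y) g′ (a ≟ a′)) }
  where
  same-or-other : ∀ {a′ y L′} → (∀ m → m < v → L′ m ≡ L m) → Descending (suc d) (a′ , y) →
    (∀ k′ → v ≡ digit (suc d) (a′ , y) k′ →
      suc k ≡ k′ × (∀ l → l Fin.≤ suc k → digit (suc d) (a , x) l ≡ digit (suc d) (a′ , y) l)) →
    (Descending d y → (∀ k′ → v ≡ digit d y k′ → k ≡ k′ × (∀ l → l Fin.≤ k → digit d x l ≡ digit d y l)) →
      Extendable d (λ z → S (L a , z)) L v y → Extendable d (λ z → S (L a , z)) L′ (suc v) y) →
    Extendable d (λ z → S (L a′ , z)) L v y → Dec (a ≡ a′) → Extendable d (λ z → S (L a′ , z)) L′ (suc v) y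
  same-or-other _ desc-y coh step g′ (yes refl) =
    step (λ l l′ lt → desc-y (suc l) (suc l′) (s<s lt))
         (λ k′ v≡ → Fin.suc-injective (proj₁ (coh (suc k′) v≡)) ,
           λ l l≤k → proj₂ (coh (suc k′) v≡) (suc l) (s≤s l≤k)) g′
  -- A branch through another column misses the node labelled `v`, hence has no digit `v`.
  same-or-other {y = y} agree _ coh _ g′ (no a≢a′) =
    extendable-skip agree d y (λ k′ v≡ → a≢a′ (proj₂ (coh (suc k′) (sym v≡)) zero z≤n)) g′

-- Moves the value at `v` up to a chosen node without disturbing the choices already made; later
-- values shift along to keep the map increasing.
raiseFrom : ∀ v δ → Increasing → Increasing
raiseFrom v δ L = fromSteps (λ m → at L m + extra m) λ m → +-mono-<-≤ (mono L (n<1+n m)) (extra-mono m)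
  where
  extra : ℕ → ℕ
  extra m with m <? v
  ... | yes _ = 0
  ... | no  _ = δ
  extra-mono : ∀ m → extra m ≤ extra (suc m)
  extra-mono m with m <? v | suc m <? v
  ... | yes _   | yes _ = z≤n
  ... | yes _   | no  _ = z≤n
  ... | no  m≮v | yes m<v = contradiction (<-trans (n<1+n m) m<v) m≮v
  ... | no  _   | no  _ = ≤-refl

raiseFrom-below : ∀ v δ L m → m < v → at (raiseFrom v δ L) m ≡ at L m
raiseFrom-below v δ L m m<v with m <? v
... | yes _  = +-identityʳ _
... | no m≮v = contradiction m<v m≮v

raiseFrom-self : ∀ v δ L → at (raiseFrom v δ L) v ≡ at L v + δ
raiseFrom-self v δ L with v <? v
... | yes v<v = contradiction v<v (n≮n v)
... | no _    = refl

-- The labels are chosen in increasing order, with `Extendable` at `v` for all elements at once as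
-- the invariant of stage `v`. Once `v` reaches `N`, every digit has been placed.
embed-pattern : ∀ d {S n} → Large d S → (e : Fin n → Ord d) →
  (∀ i → Descending d (e i)) → (∀ i i′ → Coherent d (e i) (e i′)) →
  ∀ N → (∀ i k → digit d (e i) k < N) →
  ∃[ L ] ∀ i → S (mapω d (at L) (e i))
embed-pattern d {S} {n} large e desc coh N digit<N =
  let L , ext = build N in L , λ i → extendable-finish d (e i) (digit<N i) (ext i)
  where
  build : ∀ v → ∃[ L ] ∀ i → Extendable d S (at L) v (e i)
  build zero    = idᵢ , λ i → extendable-start d (e i) large λ _ → z≤n
  build (suc v) with build v | Fin.any? (λ i → Fin.any? (λ k → digit d (e i) k ≟ v))
  ... | L , ext | no  ∄v = L , λ i → extendable-skip (λ _ _ → refl) d (e i) (λ k eq → ∄v (i , k , eq)) (ext i)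
  ... | L , ext | yes (i , k , eq) =
    let b , Lv≤b , step = extendable-step d (e i) k (desc i) eq (ext i)
        δ = b ∸ at L v
    in raiseFrom v δ L , λ i′ →
       step (raiseFrom-below v δ L) (trans (raiseFrom-self v δ L) (m+[n∸m]≡n Lv≤b)) (e i′) (desc i′)
            (λ k′ eq′ → coh i i′ k k′ (trans eq eq′)) (ext i′)

-- Copies of ω^d are large

no-descent : ∀ d (f : Ord d → Ord d) → (∀ x y → Lt d x y → Lt d (f x) (f y)) → ∀ x → ¬ Lt d (f x) x
no-descent d f f-mono x = go x (Lt-wellFounded d x)
  where
  go : ∀ x → Acc (Lt d) x → ¬ Lt d (f x) x
  -- `x`, `f x`, `f (f x)`, ... would be an infinite descent.
  go x (acc rs) fx<x = go (f x) (rs fx<x) (f-mono _ _ fx<x)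

-- Ordinal addition, in which a nonzero leading coefficient on the right absorbs the lower terms on
-- the left. The map `ordinalSum d x` re-embeds ω^d into its end segment from `x` on.
ordinalSum : ∀ d → Ord d → Ord d → Ord d
ordinalSum zero    x       y           = y
ordinalSum (suc d) (a , x) (zero  , y) = a , ordinalSum d x y
ordinalSum (suc d) (a , x) (suc b , y) = a + suc b , y

ordinalSum-monoʳ : ∀ d x y z → Lt d y z → Lt d (ordinalSum d x y) (ordinalSum d x z)
ordinalSum-monoʳ zero    x y z y<z = y<z
ordinalSum-monoʳ (suc d) (a , x) (zero  , y) (zero  , z) (inj₂ (_ , y<z)) = inj₂ (refl , ordinalSum-monoʳ d x y z y<z)
ordinalSum-monoʳ (suc d) (a , x) (zero  , y) (suc c , z) _                = inj₁ (m<m+n a z<s)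
ordinalSum-monoʳ (suc d) (a , x) (suc b , y) (suc c , z) (inj₁ b<c)          = inj₁ (+-monoʳ-< a b<c)
ordinalSum-monoʳ (suc d) (a , x) (suc b , y) (suc .b , z) (inj₂ (refl , y<z)) = inj₂ (refl , y<z)

ordinalSum-≮ : ∀ d x y → ¬ Lt d (ordinalSum d x y) x
ordinalSum-≮ zero    zero    zero        ()
ordinalSum-≮ (suc d) (a , x) (zero  , y) (inj₁ a<a)       = n≮n a a<a
ordinalSum-≮ (suc d) (a , x) (zero  , y) (inj₂ (_ , lt))  = ordinalSum-≮ d x y lt
ordinalSum-≮ (suc d) (a , x) (suc b , y) (inj₁ lt)        = m+n≮m a (suc b) lt
ordinalSum-≮ (suc d) (a , x) (suc b , y) (inj₂ (eq , _))  = <⇒≢ (m<m+n a z<s) (sym eq)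

module _ (em : ExcludedMiddle 0ℓ) where

  -- As long as some value exceeds `g x`, move `x` to a place where it is attained. Each move raises
  -- `g x`, so at most `B` moves occur; `m` counts those left.
  eventually-constant : ∀ d (g : Ord d → ℕ) → (∀ y z → Lt d y z → g y ≤ g z) → ∀ B → (∀ y → g y ≤ B) →
    ∃[ x ] ∀ y → ¬ Lt d y x → g y ≡ g x
  eventually-constant d g g-mono B g≤B = go B (fromDigits d λ _ → 0) (m≤n+m B _)
    where
    go : ∀ m x → B ≤ g x + m → ∃[ x ] ∀ y → ¬ Lt d y x → g y ≡ g x
    go m x B≤ with em {∃[ y ] g x < g y}
    go zero    x B≤ | yes (y , gx<gy) =
      contradiction (≤-trans (g≤B y) (subst (B ≤_) (+-identityʳ (g x)) B≤)) (<⇒≱ gx<gy)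
    go (suc m) x B≤ | yes (y , gx<gy) =
      go m y (≤-trans B≤ (subst (_≤ g y + m) (sym (+-suc (g x) m)) (+-monoˡ-≤ m gx<gy)))
    go m x B≤ | no maximal = x , λ y y≮x → ≤-antisym (≮⇒≥ λ lt → maximal (y , lt)) (above y y≮x)
      where
      above : ∀ y → ¬ Lt d y x → g x ≤ g y
      above y y≮x with StrictTotalOrder.compare (ω^ d) x y
      ... | tri< x<y _ _ = g-mono x y x<y
      ... | tri≈ _ x≈y _ = ≤-reflexive (cong g (≈⇒≡ d x≈y))
      ... | tri> _ _ y<x = contradiction y<x y≮x

  -- Within column `b` the leading digits of the values are nondecreasing and bounded by that of a
  -- value in column `b + 1`, so past some `x b` they equal a constant `c b`. The copy of ω^d beyond
  -- `x b` is thus embedded in a single column of `S`, and strict growth of `c` provides columns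
  -- beyond every bound.
  embedding⇒large : ∀ d {S : Ord d → Set} (f : Ord d → Ord d) → (∀ x y → Lt d x y → Lt d (f x) (f y)) →
    (∀ x → S (f x)) → Large d S
  embedding⇒large zero {S} f f-mono f∈S with f zero in eq
  ... | zero = subst S eq (f∈S zero)
  embedding⇒large (suc d) {S} f f-mono f∈S N =
    c N , b≤c N , embedding⇒large d (f′ N) (f′-mono N) (λ y → subst (λ a → S (a , f′ N y)) (column N y) (f∈S _))
    where
    stable : ∀ b → ∃[ x ] ∀ y → ¬ Lt d y x → proj₁ (f (b , y)) ≡ proj₁ (f (b , x))
    stable b = eventually-constant d (λ y → proj₁ (f (b , y)))
      (λ y z y<z → head-≤ d (f-mono (b , y) (b , z) (inj₂ (refl , y<z))))
      (proj₁ (f (suc b , fromDigits d λ _ → 0)))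
      (λ y → head-≤ d (f-mono _ _ (inj₁ (n<1+n b))))
    x : ℕ → Ord d
    x b = proj₁ (stable b)
    c : ℕ → ℕ
    c b = proj₁ (f (b , x b))
    f′ : ℕ → Ord d → Ord d
    f′ b y = proj₂ (f (b , ordinalSum d (x b) y))
    column : ∀ b y → proj₁ (f (b , ordinalSum d (x b) y)) ≡ c b
    column b y = proj₂ (stable b) (ordinalSum d (x b) y) (ordinalSum-≮ d (x b) y)
    f′-mono : ∀ b y z → Lt d y z → Lt d (f′ b y) (f′ b z)
    f′-mono b y z y<z = tail-< d (f-mono _ _ (inj₂ (refl , ordinalSum-monoʳ d (x b) y z y<z)))
      (trans (column b y) (sym (column b z)))
    -- If c b = c (b + 1), then f′ b embeds ω^d into a proper initial segment of itself.
    c-step : ∀ b → c b < c (suc b)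
    c-step b with m≤n⇒m<n∨m≡n (head-≤ d (f-mono (b , x b) (suc b , x (suc b)) (inj₁ (n<1+n b))))
    ... | inj₁ lt = lt
    ... | inj₂ eq = contradiction
      (tail-< d (f-mono (b , ordinalSum d (x b) z) (suc b , x (suc b)) (inj₁ (n<1+n b))) (trans (column b z) eq))
      (no-descent d (f′ b) (f′-mono b) z)
      where z = proj₂ (f (suc b , x (suc b)))
    b≤c : ∀ b → b ≤ c b
    b≤c zero    = z≤n
    b≤c (suc b) = ≤-trans (s≤s (b≤c b)) (c-step b)

-- A coherent labelling of the tree

-- 2^a (2m + 1)
code : ℕ → ℕ → ℕ
code m zero    = suc (m + m)
code m (suc a) = code m a + code m a

code> : ∀ m a → m < code m a
code> m zero    = s≤s (m≤m+n m m)
code> m (suc a) = ≤-trans (code> m a) (m≤m+n (code m a) (code m a))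

code-monoʳ : ∀ m {a b} → a < b → code m a < code m b
code-monoʳ m = mono (fromSteps (code m) λ a → m<m+n (code m a) (≤-<-trans z≤n (code> m a)))

double-injective : ∀ m n → m + m ≡ n + n → m ≡ n
double-injective m n eq with <-cmp m n
... | tri< m<n _ _ = contradiction eq (<⇒≢ (+-mono-< m<n m<n))
... | tri≈ _ m≡n _ = m≡n
... | tri> _ _ n<m = contradiction (sym eq) (<⇒≢ (+-mono-< n<m n<m))

odd≢even : ∀ m n → suc (m + m) ≢ n + n
odd≢even m (suc n) eq with m
... | zero  = contradiction (trans eq (cong suc (+-suc n n))) λ ()
... | suc m = odd≢even m n (ℕ.suc-injective (ℕ.suc-injective
                (trans (cong suc (sym (+-suc (suc m) m))) (trans eq (cong suc (+-suc n n))))))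

-- The odd part of a number is unique, so the label of a node determines that of its parent.
code-injectiveˡ : ∀ {m n} a b → code m a ≡ code n b → m ≡ n
code-injectiveˡ {m} {n} zero    zero    eq = double-injective m n (ℕ.suc-injective eq)
code-injectiveˡ {m} {n} zero    (suc b) eq = contradiction eq (odd≢even m (code n b))
code-injectiveˡ {m} {n} (suc a) zero    eq = contradiction (sym eq) (odd≢even n (code m a))
code-injectiveˡ {m} {n} (suc a) (suc b) eq = code-injectiveˡ a b (double-injective (code m a) (code n b) eq)

-- Here m is the label of the parent node (0 for the root, which code never returns).
encode : ∀ d → ℕ → Ord d → Ord d
encode zero    m x       = x
encode (suc d) m (a , x) = code m a , encode d (code m a) x

encode-mono : ∀ d m {x y} → Lt d x y → Lt d (encode d m x) (encode d m y)
encode-mono zero    m x<y                 = x<y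
encode-mono (suc d) m (inj₁ a<b)          = inj₁ (code-monoʳ m a<b)
encode-mono (suc d) m (inj₂ (refl , x<y)) = inj₂ (refl , encode-mono d _ x<y)

encode> : ∀ d m x k → m < digit d (encode d m x) k
encode> (suc d) m (a , x) zero    = code> m a
encode> (suc d) m (a , x) (suc k) = <-trans (code> m a) (encode> d (code m a) x k)

encode-descending : ∀ d m x → Descending d (encode d m x)
encode-descending (suc d) m (a , x) zero    (suc k′) _          = encode> d (code m a) x k′
encode-descending (suc d) m (a , x) (suc k) (suc k′) (s≤s k<k′) = encode-descending d (code m a) x k k′ k<k′

encode-parent : ∀ d m x k →
  digit (suc d) (encode (suc d) m x) (suc k) ≡
  code (digit (suc d) (encode (suc d) m x) (inject₁ k)) (digit (suc d) x (suc k))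
encode-parent (suc d) m (a , x) zero    = refl
encode-parent (suc d) m (a , x) (suc k) = encode-parent d (code m a) x k

-- Equal labels below the top level have equal parent labels, so the comparison climbs one level at
-- a time. A top-level label cannot recur deeper: the former codes `m`, the latter a label larger
-- than `m`.
encode-coherent : ∀ d m x y → Coherent d (encode d m x) (encode d m y)
encode-coherent (suc d) m x y k k′ = go (toℕ k) k k′ refl
  where
  X = digit (suc d) (encode (suc d) m x)
  Y = digit (suc d) (encode (suc d) m y)
  -- Recursion runs on the level `t`, because `inject₁ k` is not structurally smaller than `suc k`.
  go : ∀ t k k′ → toℕ k ≡ t → X k ≡ Y k′ → k ≡ k′ × (∀ l → l Fin.≤ k → X l ≡ Y l)
  go t zero     zero     _ eq = refl , λ { zero _ → eq }
  go t zero     (suc k′) _ eq = contradiction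
    (code-injectiveˡ (proj₁ x) (digit (suc d) y (suc k′)) (trans eq (encode-parent d m y k′)))
    (<⇒≢ (encode> (suc d) m y (inject₁ k′)))
  go t (suc k)  zero     _ eq = contradiction
    (code-injectiveˡ (proj₁ y) (digit (suc d) x (suc k)) (trans (sym eq) (encode-parent d m x k)))
    (<⇒≢ (encode> (suc d) m x (inject₁ k)))
  go (suc t) (suc k) (suc k′) k≡t eq
    with go t (inject₁ k) (inject₁ k′) (trans (Fin.toℕ-inject₁ k) (ℕ.suc-injective k≡t))
            (code-injectiveˡ (digit (suc d) x (suc k)) (digit (suc d) y (suc k′))
              (trans (sym (encode-parent d m x k)) (trans eq (encode-parent d m y k′))))
  ... | k≡k′ , above with Fin.inject₁-injective k≡k′
  ...   | refl = refl , λ l l≤ → case l (m≤n⇒m<n∨m≡n l≤)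
    where
    case : ∀ l → toℕ l < suc (toℕ k) ⊎ toℕ l ≡ suc (toℕ k) → X l ≡ Y l
    case l (inj₁ l<) = above l (subst (toℕ l ≤_) (sym (Fin.toℕ-inject₁ k)) (s≤s⁻¹ l<))
    case l (inj₂ l≡) with Fin.toℕ-injective {i = l} {j = suc k} l≡
    ... | refl = eq

-- Tables of coloring rules

-- One finite set gets listed in two orders, by ω^d in `FinSubset` and by keys in coloring rules;
-- this relation forgets the order.
SameMembers : ∀ {A : Set} {m n} → Vec A m → Vec A n → Set
SameMembers xs ys = (∀ {x} → x ∈ xs → x ∈ ys) × (∀ {x} → x ∈ ys → x ∈ xs)

∈-map⁻ : ∀ {A B : Set} (f : A → B) {n} (xs : Vec A n) {y} → y ∈ Vec.map f xs → ∃[ x ] x ∈ xs × y ≡ f x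
∈-map⁻ f (x ∷ xs) (here eq)    = x , here refl , eq
∈-map⁻ f (x ∷ xs) (there y∈xs) = let z , z∈xs , eq = ∈-map⁻ f xs y∈xs in z , there z∈xs , eq

sameMembers-map : ∀ {A B : Set} (f : A → B) {m n} {xs : Vec A m} {ys : Vec A n} →
                  SameMembers xs ys → SameMembers (Vec.map f xs) (Vec.map f ys)
sameMembers-map f {xs = xs} {ys} (to , from) = (λ y∈ → image xs to y∈) , (λ y∈ → image ys from y∈)
  where
  image : ∀ {m n} (xs : Vec _ m) {ys : Vec _ n} → (∀ {x} → x ∈ xs → x ∈ ys) →
          ∀ {y} → y ∈ Vec.map f xs → y ∈ Vec.map f ys
  image xs sub y∈ with ∈-map⁻ f xs y∈
  ... | x , x∈xs , refl = Vec∈.∈-map⁺ f (sub x∈xs)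

sameMembers-trans : ∀ {A : Set} {l m n} {xs : Vec A l} {ys : Vec A m} {zs : Vec A n} →
                    SameMembers xs ys → SameMembers ys zs → SameMembers xs zs
sameMembers-trans (xy , yx) (yz , zy) = (λ x∈ → yz (xy x∈)) , (λ z∈ → yx (zy z∈))

sameMembers-sym : ∀ {A : Set} {m n} {xs : Vec A m} {ys : Vec A n} → SameMembers xs ys → SameMembers ys xs
sameMembers-sym (to , from) = from , to

all-∈ : ∀ {A : Set} {Q : Pred A 0ℓ} {n} {xs : Vec A n} → (∀ {x} → x ∈ xs → Q x) → All Q xs
all-∈ {xs = []}     q = []
all-∈ {xs = x ∷ xs} q = q (here refl) ∷ all-∈ (q ∘ there)

module _ {A : Set} {R : Rel A 0ℓ} where

  allPairs-lookup : ∀ {n} {xs : Vec A n} → AllPairs R xs → ∀ i j → i Fin.< j → R (lookup xs i) (lookup xs j)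
  allPairs-lookup (x~xs ∷ _)  zero    (suc j) _         = All.lookup⁺ x~xs j
  allPairs-lookup (_ ∷ pairs) (suc i) (suc j) (s≤s i<j) = allPairs-lookup pairs i j i<j

  allPairs-tabulate : ∀ {n} (f : Fin n → A) → (∀ i j → i Fin.< j → R (f i) (f j)) → AllPairs R (tabulate f)
  allPairs-tabulate {zero}  f f~ = []
  allPairs-tabulate {suc n} f f~ =
    All.tabulate⁺ (λ j → f~ zero (suc j) z<s) ∷ allPairs-tabulate (f ∘ suc) λ i j i<j → f~ (suc i) (suc j) (s<s i<j)

lookup-ext : ∀ {A : Set} {n} {xs ys : Vec A n} → (∀ i → lookup xs i ≡ lookup ys i) → xs ≡ ys
lookup-ext {xs = xs} {ys} eq =
  trans (sym (Vec.tabulate∘lookup xs)) (trans (Vec.tabulate-cong eq) (Vec.tabulate∘lookup ys))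

module _ (S : LinearOrder) where
  open StrictTotalOrder S using (Carrier; _≈_; compare) renaming (_<_ to _≺_)
  private module S = StrictTotalOrder S

  insert : ∀ {n} x {ys : Vec Carrier n} → All (λ y → ¬ x ≈ y) ys → AllPairs _≺_ ys →
           ∃[ zs ] AllPairs _≺_ {suc n} zs × SameMembers (x ∷ ys) zs
  insert x {[]}     _            _ = x ∷ [] , [] ∷ [] , id , id
  insert x {y ∷ ys} (x≉y ∷ x≉ys) (y<ys ∷ ys↗) with compare x y
  ... | tri< x<y _ _ = x ∷ y ∷ ys , (x<y ∷ All.map (S.trans x<y) y<ys) ∷ y<ys ∷ ys↗ , id , id
  ... | tri≈ _ x≈y _ = contradiction x≈y x≉y
  ... | tri> _ _ y<x =
    let zs , zs↗ , to , from = insert x x≉ys ys↗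
    in  y ∷ zs , all-∈ (λ z∈zs → All.lookup (y<x ∷ y<ys) (from z∈zs)) ∷ zs↗
      , (λ { (here eq)         → there (to (here eq))
           ; (there (here eq)) → here eq
           ; (there (there z)) → there (to (there z)) })
      , (λ { (here eq) → there (here eq)
           ; (there z) → swap (from z) })
    where
    swap : ∀ {z} → z ∈ (x ∷ ys) → z ∈ (x ∷ y ∷ ys)
    swap (here eq) = here eq
    swap (there z) = there (there z)

  sort : ∀ {n} (xs : Vec Carrier n) → AllPairs (λ x y → ¬ x ≈ y) xs → ∃[ ys ] AllPairs _≺_ {n} ys × SameMembers xs ys
  sort []       _            = [] , [] , id , id
  sort (x ∷ xs) (x≉xs ∷ xs!) =
    let ys , ys↗ , to , from    = sort xs xs!
        zs , zs↗ , to′ , from′ = insert x (all-∈ λ y∈ys → All.lookup x≉xs (from y∈ys)) ys↗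
    in  zs , zs↗
      , (λ { (here eq) → to′ (here eq) ; (there z) → to′ (there (to z)) })
      , (λ z∈zs → [x∷from] from (from′ z∈zs))
    where
    [x∷from] : ∀ {ys : Vec Carrier _} → (∀ {z} → z ∈ ys → z ∈ xs) → ∀ {z} → z ∈ (x ∷ ys) → z ∈ (x ∷ xs)
    [x∷from] from (here eq) = here eq
    [x∷from] from (there z) = there (from z)

  -- Either head is the least member. Membership is propositional, so equality results even for
  -- `byKey`, whose `_≈_` compares only keys.
  sorted-unique : ∀ {n} {xs ys : Vec Carrier n} → AllPairs _≺_ xs → AllPairs _≺_ ys → SameMembers xs ys → xs ≡ ys
  sorted-unique {xs = []} {[]} _ _ _ = refl
  sorted-unique {xs = x ∷ xs} {y ∷ ys} (x<xs ∷ xs↗) (y<ys ∷ ys↗) (to , from) with heads (to (here refl)) (from (here refl))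
    where
    heads : x ∈ (y ∷ ys) → y ∈ (x ∷ xs) → x ≡ y
    heads (here eq)    _            = eq
    heads (there _)    (here eq)    = sym eq
    heads (there x∈ys) (there y∈xs) = contradiction (All.lookup y<ys x∈ys) (S.asym (All.lookup x<xs y∈xs))
  ... | refl = cong (x ∷_) (sorted-unique xs↗ ys↗
      ( (λ z∈xs → drop x<xs z∈xs (to (there z∈xs)))
      , (λ z∈ys → drop y<ys z∈ys (from (there z∈ys)))))
    where
    drop : ∀ {zs ws : Vec Carrier _} → All (x ≺_) zs → ∀ {z} → z ∈ zs → z ∈ (x ∷ ws) → z ∈ ws
    drop x<zs z∈zs (here refl)  = contradiction (All.lookup x<zs z∈zs) (S.irrefl S.Eq.refl)
    drop x<zs z∈zs (there z∈ws) = z∈ws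

-- Counting in finite sets and filtered lists

∣p∪q∣≤∣p∣+∣q∣ : ∀ {n} (p q : Subset n) → ∣ p ∪ q ∣ ≤ ∣ p ∣ + ∣ q ∣
∣p∪q∣≤∣p∣+∣q∣ []            []            = z≤n
∣p∪q∣≤∣p∣+∣q∣ (inside ∷ p)  (outside ∷ q) = s≤s (∣p∪q∣≤∣p∣+∣q∣ p q)
∣p∪q∣≤∣p∣+∣q∣ (inside ∷ p)  (inside ∷ q)  =
  s≤s (≤-trans (∣p∪q∣≤∣p∣+∣q∣ p q) (+-monoʳ-≤ ∣ p ∣ (n≤1+n ∣ q ∣)))
∣p∪q∣≤∣p∣+∣q∣ (outside ∷ p) (outside ∷ q) = ∣p∪q∣≤∣p∣+∣q∣ p q
∣p∪q∣≤∣p∣+∣q∣ (outside ∷ p) (inside ∷ q)  =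
  subst (suc ∣ p ∪ q ∣ ≤_) (sym (+-suc ∣ p ∣ ∣ q ∣)) (s≤s (∣p∪q∣≤∣p∣+∣q∣ p q))

range : ∀ {t c} → (Fin t → Fin c) → Subset c
range {zero}  k = ⊥
range {suc t} k = ⁅ k zero ⁆ ∪ range (k ∘ suc)

∈-range : ∀ {t c} (k : Fin t → Fin c) i → k i Subset.∈ range k
∈-range k zero    = Subset.x∈p∪q⁺ (inj₁ (Subset.x∈⁅x⁆ (k zero)))
∈-range k (suc i) = Subset.x∈p∪q⁺ (inj₂ (∈-range (k ∘ suc) i))

∣range∣≤ : ∀ {t c} (k : Fin t → Fin c) → ∣ range k ∣ ≤ t
∣range∣≤ {zero}  {c} k = ≤-reflexive (Subset.∣⊥∣≡0 c)
∣range∣≤ {suc t} k     = ≤-trans (∣p∪q∣≤∣p∣+∣q∣ ⁅ k zero ⁆ _)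
  (+-mono-≤ (≤-reflexive (Subset.∣⁅x⁆∣≡1 (k zero))) (∣range∣≤ (k ∘ suc)))

covered⇒∣p∣≤ : ∀ {t c} (k : Fin t → Fin c) {p} → (∀ {x} → x Subset.∈ p → ∃[ i ] k i ≡ x) → ∣ p ∣ ≤ t
covered⇒∣p∣≤ k cover = ≤-trans
  (Subset.p⊆q⇒∣p∣≤∣q∣ λ x∈p → let i , eq = cover x∈p in subst (Subset._∈ range k) eq (∈-range k i)) (∣range∣≤ k)

-- The colors `suc i` will stand for the rules, whereas `zero` is left for sets that satisfy none.
sucs∈p⇒≤∣p∣ : ∀ {t} (p : Subset (suc t)) → (∀ i → suc i Subset.∈ p) → t ≤ ∣ p ∣
sucs∈p⇒≤∣p∣ {t} (s ∷ p) sucs∈ = ≤-trans (≤-reflexive (sym (Subset.∣⊤∣≡n t)))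
  (≤-trans (Subset.p⊆q⇒∣p∣≤∣q∣ {p = ⊤} λ {i} _ → Subset.drop-there (sucs∈ i)) (Subset.∣p∣≤∣x∷p∣ s p))

module _ {A : Set} {Q Q′ : Pred A 0ℓ} (Q? : Decidable Q) (Q′? : Decidable Q′) (Q⇒Q′ : ∀ {x} → Q x → Q′ x) where

  length-filter-mono-≤ : ∀ xs → length (filter Q? xs) ≤ length (filter Q′? xs)
  length-filter-mono-≤ []       = z≤n
  length-filter-mono-≤ (x ∷ xs) with Q? x | Q′? x
  ... | yes q | yes _  = s≤s (length-filter-mono-≤ xs)
  ... | yes q | no ¬q′ = contradiction (Q⇒Q′ q) ¬q′
  ... | no _  | yes _  = m≤n⇒m≤1+n (length-filter-mono-≤ xs)
  ... | no _  | no _   = length-filter-mono-≤ xs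

  length-filter-mono-< : ∀ {x xs} → x ∈ₗ xs → ¬ Q x → Q′ x → length (filter Q? xs) < length (filter Q′? xs)
  length-filter-mono-< {xs = x ∷ xs} (ListAny.here refl) ¬q q′ with Q? x | Q′? x
  ... | yes q | _      = contradiction q ¬q
  ... | no _  | yes _  = s≤s (length-filter-mono-≤ xs)
  ... | no _  | no ¬q′ = contradiction q′ ¬q′
  length-filter-mono-< {xs = y ∷ xs} (ListAny.there x∈) ¬q q′ with Q? y | Q′? y
  ... | yes q | yes _  = s≤s (length-filter-mono-< x∈ ¬q q′)
  ... | yes q | no ¬q′ = contradiction (Q⇒Q′ q) ¬q′
  ... | no _  | yes _  = m≤n⇒m≤1+n (length-filter-mono-< x∈ ¬q q′)
  ... | no _  | no _   = length-filter-mono-< x∈ ¬q q′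

-- Vectors of ordinals and their tables

-- For d = 0 every key is 0, so that rules (1) and (1-0) both say that the keys increase.
key : ∀ d → Ord d → ℕ
key zero    x = 0
key (suc d) x = digit (suc d) x (fromℕ d)

byKey : ℕ → LinearOrder
byKey d = On.strictTotalOrder ω (key d)

KeyLt : ∀ d → Ord d → Ord d → Set
KeyLt d = StrictTotalOrder._<_ (byKey d)

firstIndex : ∀ d → d ≡ 0 ⊎ (∃[ j ] toℕ {d} j ≡ 0)
firstIndex zero    = inj₁ refl
firstIndex (suc d) = inj₂ (zero , refl)

key≡digit : ∀ {d} (j : Fin d) → toℕ j ≡ 0 → ∀ x → key d x ≡ digit d x (opposite j)
key≡digit zero _ x = refl

-- `opposite` passes from the exponent of ω in a coloring rule to the position counted from the
-- leading digit.
value : ∀ d {n} → Vec (Ord d) n → Index n d → ℕ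
value d e (i , j) = digit d (lookup e i) (opposite j)

tableOf : ∀ d {n} → Vec (Ord d) n → Table n d
tableOf d e = tabulate λ i → tabulate λ j → tabulate λ i′ → tabulate λ j′ →
  (value d e (i , j) ≤ᵇ value d e (i′ , j′))

entry-tableOf : ∀ d {n} (e : Vec (Ord d) n) p q → entry (tableOf d e) p q ≡ (value d e p ≤ᵇ value d e q)
entry-tableOf d e (i , j) (i′ , j′) =
  trans (cong (λ R → lookup (lookup (lookup R j) i′) j′) (Vec.lookup∘tabulate _ i))
  (trans (cong (λ R → lookup (lookup R i′) j′) (Vec.lookup∘tabulate _ j))
  (trans (cong (λ R → lookup R j′) (Vec.lookup∘tabulate _ i′)) (Vec.lookup∘tabulate _ j′)))

entry⇒≤ : ∀ d {n} (e : Vec (Ord d) n) p q → T (entry (tableOf d e) p q) → value d e p ≤ value d e q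
entry⇒≤ d e p q t = ≤ᵇ⇒≤ _ _ (subst T (entry-tableOf d e p q) t)

≤⇒entry : ∀ d {n} (e : Vec (Ord d) n) p q → value d e p ≤ value d e q → T (entry (tableOf d e) p q)
≤⇒entry d e p q le = subst T (sym (entry-tableOf d e p q)) (≤⇒≤ᵇ le)

T-ext : ∀ {b c} → (T b → T c) → (T c → T b) → b ≡ c
T-ext {true}  {true}  _ _ = refl
T-ext {false} {false} _ _ = refl
T-ext {true}  {false} f _ with () ← f _
T-ext {false} {true}  _ g with () ← g _

table-ext : ∀ {n d} {R R′ : Table n d} → (∀ p q → entry R p q ≡ entry R′ p q) → R ≡ R′
table-ext eq = lookup-ext λ i → lookup-ext λ j → lookup-ext λ i′ → lookup-ext λ j′ → eq (i , j) (i′ , j′)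

-- The rules read on digits: `descending` is (3), `coherent` is (4) and (5), `keys` is (1) together
-- with its case d = 0.
record Arranged d {n} (e : Vec (Ord d) n) : Set where
  field
    descending : ∀ i → Descending d (lookup e i)
    coherent   : ∀ i i′ → Coherent d (lookup e i) (lookup e i′)
    keys       : AllPairs (KeyLt d) e

opposite-anti-< : ∀ {d} (j j′ : Fin d) → j Fin.< j′ → opposite j′ Fin.< opposite j
opposite-anti-< j j′ j<j′ = subst₂ _<_ (sym (Fin.opposite-prop j′)) (sym (Fin.opposite-prop j))
  (∸-monoʳ-< (s<s j<j′) (Fin.toℕ<n j′))

opposite-pred : ∀ {d} {k l : Fin d} → toℕ k ≡ suc (toℕ l) → toℕ (opposite l) ≡ suc (toℕ (opposite k))
opposite-pred {d} {k} {l} k≡1+l = begin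
  toℕ (opposite l)            ≡⟨ Fin.opposite-prop l ⟩
  d ∸ suc (toℕ l)             ≡⟨ +-∸-assoc 1 (subst (_< d) k≡1+l (Fin.toℕ<n k)) ⟩
  suc (d ∸ suc (suc (toℕ l))) ≡⟨ cong (λ m → suc (d ∸ suc m)) k≡1+l ⟨
  suc (d ∸ suc (toℕ k))       ≡⟨ cong suc (Fin.opposite-prop k) ⟨
  suc (toℕ (opposite k))      ∎
  where open ≡-Reasoning

opposite-injective : ∀ {d} {j j′ : Fin d} → opposite j ≡ opposite j′ → j ≡ j′
opposite-injective eq = trans (sym (Fin.opposite-involutive _)) (trans (cong opposite eq) (Fin.opposite-involutive _))

module _ d {n} (e : Vec (Ord d) n) (arr : Arranged d e) where
  open Arranged arr

  arranged⇒isCR : (Y : Vec (Fin 1) n) → IsCR n d 1 (Y , tableOf d e)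
  arranged⇒isCR Y = record
    { isTotalPreorder = record
      { isPreorder = record
        { isEquivalence = isEquivalence
        ; reflexive     = λ { {p} refl → ≤⇒entry d e p p ≤-refl }
        ; trans         = λ {p} {q} {r} pq qr → ≤⇒entry d e p r (≤-trans (entry⇒≤ d e p q pq) (entry⇒≤ d e q r qr))
        }
      ; total = λ p q → [ inj₁ ∘ ≤⇒entry d e p q , inj₂ ∘ ≤⇒entry d e q p ]′ (≤-total (value d e p) (value d e q))
      }
    ; rule1   = λ i i′ j i<i′ j≡0 → strict (i , j) (i′ , j) 
        (subst₂ _<_ (key≡digit j j≡0 (lookup e i)) (key≡digit j j≡0 (lookup e i′)) (allPairs-lookup keys i i′ i<i′))
    ; rule1-0 = λ { refl i i′ i<i′ → contradiction (allPairs-lookup keys i i′ i<i′) (n≮n 0) }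
    ; rule2   = λ i i′ j _ → Fin1-prop (lookup Y i) (lookup Y i′)
    ; rule3   = λ i j j′ j′<j → strict (i , j) (i , j′)
        (descending i (opposite j) (opposite j′) (opposite-anti-< j′ j j′<j))
    ; rule4   = λ i i′ j j′ eq → opposite-injective (proj₁ (coherent i i′ _ _ (equal (i , j) (i′ , j′) eq)))
    ; rule5   = λ i i′ j j⁻ j≡ j≢ j⁻≡ → j≢ (equiv (i , j) (i′ , j)
        (proj₂ (coherent i i′ _ _ (equal (i , j⁻) (i′ , j⁻) j⁻≡)) (opposite j)
               (<⇒≤ (opposite-anti-< j⁻ j (≤-reflexive (sym j≡))))))
    }
    where
    strict : ∀ p q → value d e p < value d e q → T (entry (tableOf d e) p q) × ¬ T (entry (tableOf d e) q p)
    strict p q lt = ≤⇒entry d e p q (<⇒≤ lt) , λ t → <⇒≱ lt (entry⇒≤ d e q p t)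
    equal : ∀ p q → T (entry (tableOf d e) p q) × T (entry (tableOf d e) q p) → value d e p ≡ value d e q
    equal p q (pq , qp) = ≤-antisym (entry⇒≤ d e p q pq) (entry⇒≤ d e q p qp)
    equiv : ∀ p q → value d e p ≡ value d e q → T (entry (tableOf d e) p q) × T (entry (tableOf d e) q p)
    equiv p q eq = ≤⇒entry d e p q (≤-reflexive eq) , ≤⇒entry d e q p (≤-reflexive (sym eq))
    Fin1-prop : (x y : Fin 1) → x ≡ y
    Fin1-prop zero zero = refl

-- The pattern of a coloring rule

module Pattern (n d : ℕ) (Y : Vec (Fin 1) n) (R : Table n d) (cr : IsCR n d 1 (Y , R)) where
  open IsColoringRule cr
  open IsTotalPreorder isTotalPreorder using (total) renaming (refl to ⪯-refl; trans to ⪯-trans)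

  indices : List (Index n d)
  indices = cartesianProduct (allFin n) (allFin d)

  ∈-indices : ∀ p → p ∈ₗ indices
  ∈-indices (i , j) = List.∈-cartesianProduct⁺ (List.∈-allFin i) (List.∈-allFin j)

  below? : ∀ p → Decidable (λ q → ¬ T (entry R p q))
  below? p q = ¬? (T? (entry R p q))

  -- By totality this counts the indices strictly below `p`, so equivalent indices share a rank and
  -- the preorder becomes the order of the ranks.
  rank : Index n d → ℕ
  rank p = length (filter (below? p) indices)

  rank≤ : ∀ p → rank p ≤ length indices
  rank≤ p = List.length-filter (below? p) indices

  rank-mono : ∀ p q → T (entry R p q) → rank p ≤ rank q
  rank-mono p q p⪯q = length-filter-mono-≤ (below? p) (below? q) (λ p⋠r q⪯r → p⋠r (⪯-trans p⪯q q⪯r)) indices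

  rank-strict : ∀ p q → T (entry R p q) → ¬ T (entry R q p) → rank p < rank q
  rank-strict p q p⪯q q⋠p = length-filter-mono-< (below? p) (below? q) (λ p⋠r q⪯r → p⋠r (⪯-trans p⪯q q⪯r))
    -- The extra index counted for `q` is `p` itself.
    (∈-indices p) (λ p⋠p → p⋠p ⪯-refl) q⋠p

  rank-cancel : ∀ p q → rank p ≤ rank q → T (entry R p q)
  rank-cancel p q le with T? (entry R p q) | total p q
  ... | yes p⪯q | _       = p⪯q
  ... | no _    | inj₁ pq = pq
  ... | no p⋠q  | inj₂ qp = contradiction le (<⇒≱ (rank-strict q p qp p⋠q))

  -- Ranks as digits give a template for the rule: both bounds produce sets of this rule by applying
  -- increasing maps to its digits.
  element : Fin n → Ord d
  element i = fromDigits d λ k → rank (i , opposite k)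

  elements : Vec (Ord d) n
  elements = tabulate element

  digit-element : ∀ i k → digit d (lookup elements i) k ≡ rank (i , opposite k)
  digit-element i k = trans (cong (λ x → digit d x k) (Vec.lookup∘tabulate element i)) (digit-fromDigits d _ k)

  value-elements : ∀ p → value d elements p ≡ rank p
  value-elements (i , j) = trans (digit-element i (opposite j)) (cong (λ j → rank (i , j)) (Fin.opposite-involutive j))

  tableOf-elements : tableOf d elements ≡ R
  tableOf-elements = table-ext λ p q → T-ext
    (λ t → rank-cancel p q (subst₂ _≤_ (value-elements p) (value-elements q) (entry⇒≤ d elements p q t)))
    (λ t → ≤⇒entry d elements p q (subst₂ _≤_ (sym (value-elements p)) (sym (value-elements q)) (rank-mono p q t)))

  arranged : Arranged d elements
  arranged = record
    { descending = λ i k k′ k<k′ → subst₂ _<_ (sym (digit-element i k)) (sym (digit-element i k′))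
        (let p , q = rule3 i (opposite k) (opposite k′) (opposite-anti-< k k′ k<k′) in rank-strict _ _ p q)
    ; coherent = λ i i′ k k′ eq →
        let eq′ = trans (sym (digit-element i k)) (trans eq (digit-element i′ k′))
            k≡k′ = opposite-injective (rule4 i i′ _ _ (equivalent eq′))
        in k≡k′ , λ l l≤k → trans (digit-element i l) (trans
             (ancestors i i′ (toℕ k) k refl
               (subst (λ k′ → rank (i , opposite k) ≡ rank (i′ , opposite k′)) (sym k≡k′) eq′) l l≤k)
             (sym (digit-element i′ l)))
    ; keys = allPairs-tabulate element (λ i i′ i<i′ → keys-increase i i′ i<i′)
    }
    where
    equivalent : ∀ {p q} → rank p ≡ rank q → T (entry R p q) × T (entry R q p)
    equivalent {p} {q} eq = rank-cancel p q (≤-reflexive eq) , rank-cancel q p (≤-reflexive (sym eq))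
    parent : ∀ i i′ j j⁻ → toℕ j ≡ suc (toℕ j⁻) → rank (i , j⁻) ≡ rank (i′ , j⁻) → rank (i , j) ≡ rank (i′ , j)
    parent i i′ j j⁻ j≡ eq =
      -- Rule (5) yields the equivalence at the parent level only up to double negation.
      let ij , ji = decidable-stable (T? (entry R (i , j) (i′ , j)) ×-dec T? (entry R (i′ , j) (i , j)))
                      (λ j≢ → rule5 i i′ j j⁻ j≡ j≢ (equivalent eq))
      in ≤-antisym (rank-mono _ _ ij) (rank-mono _ _ ji)
    ancestors : ∀ i i′ t k → toℕ k ≡ t → rank (i , opposite k) ≡ rank (i′ , opposite k) →
      ∀ l → l Fin.≤ k → rank (i , opposite l) ≡ rank (i′ , opposite l)
    ancestors i i′ t k k≡t eq l l≤k with m≤n⇒m<n∨m≡n l≤k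
    ... | inj₂ l≡k = subst (λ k → rank (i , opposite k) ≡ rank (i′ , opposite k)) (sym (Fin.toℕ-injective l≡k)) eq
    ancestors i i′ (suc t) (suc k) k≡t eq l _ | inj₁ l<k =
      ancestors i i′ t (inject₁ k) (trans (Fin.toℕ-inject₁ k) (ℕ.suc-injective k≡t))
        (parent i i′ _ _ (opposite-pred (cong suc (sym (Fin.toℕ-inject₁ k)))) eq)
        l (subst (toℕ l ≤_) (sym (Fin.toℕ-inject₁ k)) (s≤s⁻¹ l<k))
    keys-increase : ∀ i i′ → i Fin.< i′ → key d (element i) < key d (element i′)
    keys-increase i i′ i<i′ with firstIndex d
    ... | inj₁ d≡0 = contradiction (rule1-0 d≡0 i i′ i<i′) Fin1-≮
      where
      Fin1-≮ : {x y : Fin 1} → ¬ x Fin.< y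
      Fin1-≮ {_} {zero} ()
    ... | inj₂ (j , j≡0) = subst₂ _<_ (key-rank i) (key-rank i′)
      (let p , q = rule1 i i′ j i<i′ j≡0 in rank-strict (i , j) (i′ , j) p q)
      where
      key-rank : ∀ i → rank (i , j) ≡ key d (element i)
      key-rank i = sym (trans (key≡digit j j≡0 (element i))
        (trans (digit-fromDigits d _ (opposite j)) (cong (λ j → rank (i , j)) (Fin.opposite-involutive j))))

-- The list of all coloring rules

vectors-complete : ∀ {A : Set} {xs : List A} → (∀ x → x ∈ₗ xs) → ∀ n v → v ∈ₗ vectors n xs
vectors-complete xs∋ zero    []      = ListAny.here refl
vectors-complete xs∋ (suc n) (x ∷ v) = List.∈-cartesianProductWith⁺ _∷_ (xs∋ x) (vectors-complete xs∋ n v)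

vectors-unique : ∀ {A : Set} {xs : List A} → Unique xs → ∀ n → Unique (vectors n xs)
vectors-unique xs! zero    = ListAll.[] ListAllPairs.∷ ListAllPairs.[]
vectors-unique xs! (suc n) = Unique.cartesianProductWith⁺ _∷_ Vec.∷-injective xs! (vectors-unique xs! n)

lookup-injective : ∀ {A : Set} {xs : List A} → Unique xs → ∀ i j → List.lookup xs i ≡ List.lookup xs j → i ≡ j
lookup-injective (_ ListAllPairs.∷ _)     zero    zero    _  = refl
lookup-injective (x∉ ListAllPairs.∷ _)    zero    (suc j) eq = contradiction eq (ListAll.lookup x∉ (List.∈-lookup j))
lookup-injective (x∉ ListAllPairs.∷ _)    (suc i) zero    eq = contradiction (sym eq) (ListAll.lookup x∉ (List.∈-lookup i))
lookup-injective (_ ListAllPairs.∷ xs!)   (suc i) (suc j) eq = cong suc (lookup-injective xs! i j eq)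

module ColoringRules (n d : ℕ) where

  rules : List (Vec (Fin 1) n × Table n d)
  rules = filter (isCR? n d 1) (cartesianProduct (vectors n (allFin 1)) (tables n d))

  rule : Fin (P n d 1) → Vec (Fin 1) n × Table n d
  rule = List.lookup rules

  table : Fin (P n d 1) → Table n d
  table i = proj₂ (rule i)

  rule-isCR : ∀ i → IsCR n d 1 (rule i)
  rule-isCR i = proj₂ (List.∈-filter⁻ (isCR? n d 1) {xs = cartesianProduct (vectors n (allFin 1)) (tables n d)}
    (List.∈-lookup {xs = rules} i))

  rule-complete : ∀ YR → IsCR n d 1 YR → ∃[ i ] rule i ≡ YR
  rule-complete (Y , R) cr = ListAny.index YR∈ , sym (ListAny.lookup-index YR∈)
    where
    bools∋ : ∀ b → b ∈ₗ (false ∷ true ∷ [])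
    bools∋ false = ListAny.here refl
    bools∋ true  = ListAny.there (ListAny.here refl)
    YR∈ : (Y , R) ∈ₗ rules
    YR∈ = List.∈-filter⁺ (isCR? n d 1) (List.∈-cartesianProduct⁺
      (vectors-complete List.∈-allFin n Y)
      (vectors-complete (vectors-complete (vectors-complete (vectors-complete bools∋ d) n) d) n R)) cr

  rules-unique : Unique rules
  rules-unique = Unique.filter⁺ (isCR? n d 1) (Unique.cartesianProduct⁺
    (vectors-unique (Unique.allFin⁺ 1) n)
    (vectors-unique (vectors-unique (vectors-unique (vectors-unique bools! d) n) d) n))
    where
    bools! : Unique (false ∷ true ∷ [])
    bools! = ((λ ()) ListAll.∷ ListAll.[]) ListAllPairs.∷ ListAll.[] ListAllPairs.∷ ListAllPairs.[]

  -- For k = 1 only one `Y` exists, so a rule is known from its table.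
  table-injective : ∀ i j → table i ≡ table j → i ≡ j
  table-injective i j eq = lookup-injective rules-unique i j (cong₂ _,_ (constant _ _) eq)
    where
    constant : ∀ {n} (Y Y′ : Vec (Fin 1) n) → Y ≡ Y′
    constant []         []          = refl
    constant (zero ∷ Y) (zero ∷ Y′) = cong (zero ∷_) (constant Y Y′)

-- The two bounds

map-cong-∈ : ∀ {A B : Set} {f g : A → B} {n} (xs : Vec A n) → (∀ {x} → x ∈ xs → f x ≡ g x) → Vec.map f xs ≡ Vec.map g xs
map-cong-∈ []       eq = refl
map-cong-∈ (x ∷ xs) eq = cong₂ _∷_ (eq (here refl)) (map-cong-∈ xs (eq ∘ there))

key-mapω-mono : ∀ d L {x y} → key d x < key d y → key d (mapω d (at L) x) < key d (mapω d (at L) y)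
key-mapω-mono (suc d) L {x} {y} lt = subst₂ _<_
  (sym (digit-mapω (suc d) (at L) x (fromℕ d))) (sym (digit-mapω (suc d) (at L) y (fromℕ d))) (mono L lt)

-- The last label determines the whole branch, so distinct elements of a coherent set have distinct
-- keys and can be listed by key.
coherent-key : ∀ d {x y} → Coherent d x y → key d x ≡ key d y → x ≡ y
coherent-key zero    {zero} {zero} _ _ = refl
coherent-key (suc d) coh eq = digit-injective (suc d) λ k → proj₂ (coh (fromℕ d) (fromℕ d) eq) k (Fin.≤fromℕ k)

coherent-mapω : ∀ d L {x y} → Coherent d x y → Coherent d (mapω d (at L) x) (mapω d (at L) y)
coherent-mapω d L {x} {y} coh k k′ eq =
  let k≡k′ , above = coh k k′ (at-injective L (trans (sym (digit-mapω d _ x k)) (trans eq (digit-mapω d _ y k′))))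
  in k≡k′ , λ l l≤k → trans (digit-mapω d _ x l) (trans (cong (at L) (above l l≤k)) (sym (digit-mapω d _ y l)))

descending-mapω : ∀ d L {x} → Descending d x → Descending d (mapω d (at L) x)
descending-mapω d L {x} desc k k′ k<k′ =
  subst₂ _<_ (sym (digit-mapω d _ x k)) (sym (digit-mapω d _ x k′)) (mono L (desc k k′ k<k′))

value-mapω : ∀ d L {n} (e : Vec (Ord d) n) p → value d (Vec.map (mapω d (at L)) e) p ≡ at L (value d e p)
value-mapω d L e (i , j) = trans (cong (λ x → digit d x (opposite j)) (Vec.lookup-map i (mapω d (at L)) e))
  (digit-mapω d (at L) (lookup e i) (opposite j))

tableOf-mapω : ∀ d L {n} (e : Vec (Ord d) n) → tableOf d (Vec.map (mapω d (at L)) e) ≡ tableOf d e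
tableOf-mapω d L e = table-ext λ p q → T-ext
  (λ t → ≤⇒entry d e p q (cancel-≤ L
           (subst₂ _≤_ (value-mapω d L e p) (value-mapω d L e q) (entry⇒≤ d (Vec.map (mapω d (at L)) e) p q t))))
  (λ t → ≤⇒entry d (Vec.map (mapω d (at L)) e) p q
           (subst₂ _≤_ (sym (value-mapω d L e p)) (sym (value-mapω d L e q)) (mono-≤ L (entry⇒≤ d e p q t))))

module _ (d : ℕ) (F : Ord d → Ord d) (F-mono : ∀ {x y} → Lt d x y → Lt d (F x) (F y)) where

  Image : Pred (Ord d) 0ℓ
  Image y = ∃[ x ] F x ≡ y

  private
    open module O = StrictTotalOrder (ω^ d) using (_≈_; compare)

  F-cong : ∀ {x y} → x ≈ y → F x ≈ F y
  F-cong x≈y = O.Eq.reflexive (cong F (≈⇒≡ d x≈y))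

  image≈ : OrderEquivalent (ω^ d) Image
  image≈ = (λ x → F x , x , refl) , record
    { isOrderMonomorphism = record
      { isOrderHomomorphism = record { cong = F-cong ; mono = F-mono }
      ; injective           = λ {x} {y} → injective x y
      ; cancel              = λ {x} {y} → cancel x y
      }
    ; surjective = λ { (_ , x , refl) → x , F-cong }
    }
    where
    injective : ∀ x y → F x ≈ F y → x ≈ y
    injective x y eq with compare x y
    ... | tri< x<y _ _ = contradiction (F-mono x<y) (O.irrefl eq)
    ... | tri≈ _ x≈y _ = x≈y
    ... | tri> _ _ y<x = contradiction (F-mono y<x) (O.irrefl (O.Eq.sym eq))
    cancel : ∀ x y → Lt d (F x) (F y) → Lt d x y
    cancel x y lt with compare x y
    ... | tri< x<y _ _ = x<y
    ... | tri≈ _ x≈y _ = contradiction lt (O.irrefl (F-cong x≈y))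
    ... | tri> _ _ y<x = contradiction lt (O.asym (F-mono y<x))

module _ (em : ExcludedMiddle 0ℓ) where

  comprehension : ∀ {c} (Q : Fin c → Set) → ∃[ C ] ∀ x → (x Subset.∈ C → Q x) × (Q x → x Subset.∈ C)
  comprehension {c} Q = tabulate side , λ x →
      (λ x∈C → to x (trans (sym (Vec.lookup∘tabulate side x)) (Vec.[]=⇒lookup x∈C)))
    , (λ q → Vec.lookup⇒[]= x _ (trans (Vec.lookup∘tabulate side x) (from x q)))
    where
    side : Fin c → Bool
    side x = does (em {Q x})
    to : ∀ x → side x ≡ true → Q x
    to x eq with em {Q x}
    to x refl | yes q = q
    from : ∀ x → Q x → side x ≡ true
    from x q with em {Q x}
    ... | yes _ = refl
    ... | no ¬q = contradiction q ¬q

module _ (em : ExcludedMiddle 0ℓ) (n d : ℕ) where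
  open ColoringRules n d
  open FinSubset using (elements)

  Subsetω : Set
  Subsetω = FinSubset (ω^ d) n

  N : ℕ
  N = length (cartesianProduct (allFin n) (allFin d))

  module Pat i = Pattern n d (proj₁ (rule i)) (table i) (rule-isCR i)
  module Arr i = Arranged (Pat.arranged i)

  digit≤N : ∀ i j k → digit d (lookup (Pat.elements i) j) k ≤ N
  digit≤N i j k = subst (_≤ N) (sym (Pat.digit-element i j k)) (Pat.rank≤ i _)

  sorted : ∀ i → ∃[ ys ] AllPairs (Lt d) {n} ys × SameMembers (Pat.elements i) ys
  sorted i = sort (ω^ d) (Pat.elements i)
    (AllPairs.map (λ lt x≈y → <⇒≢ lt (cong (key d) (≈⇒≡ d x≈y))) (Arr.keys i))

  patternSet : ∀ i → Subsetω
  patternSet i = finSubset (proj₁ (sorted i)) (proj₁ (proj₂ (sorted i)))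

  pattern~ : ∀ i → SameMembers (Pat.elements i) (elements (patternSet i))
  pattern~ i = proj₂ (proj₂ (sorted i))

  mapSet : Increasing → Subsetω → Subsetω
  mapSet L (finSubset xs xs↗) =
    finSubset (Vec.map (mapω d (at L)) xs) (AllPairs.map⁺ (AllPairs.map (mapω-mono d L) xs↗))

  patternSet-∈ : ∀ i {x} → x ∈ elements (patternSet i) → ∃[ j ] x ≡ lookup (Pat.elements i) j
  patternSet-∈ i x∈ = let x∈′ = proj₂ (pattern~ i) x∈ in Any.index x∈′ , Any.lookup-index x∈′

  -- A set is compared with a rule through its listing by keys, because rule (1) orders the indices
  -- i by the last digit.
  Realises : Subsetω → Table n d → Set
  Realises A R = ∃[ e ] AllPairs (KeyLt d) {n} e × SameMembers (elements A) e × tableOf d e ≡ R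

  -- The listing by keys is unique; this makes the coloring by rules well defined.
  realises-unique : ∀ A {R R′} → Realises A R → Realises A R′ → R ≡ R′
  realises-unique A (e , e↗ , A~e , refl) (e′ , e′↗ , A~e′ , refl) =
    cong (tableOf d) (sorted-unique (byKey d) e↗ e′↗ (sameMembers-trans (sameMembers-sym A~e) A~e′))

  realises-mapSet : ∀ L i → Realises (mapSet L (patternSet i)) (table i)
  realises-mapSet L i = Vec.map (mapω d (at L)) (Pat.elements i)
    , AllPairs.map⁺ (AllPairs.map (key-mapω-mono d L) (Arr.keys i))
    , sameMembers-map _ (sameMembers-sym (pattern~ i))
    , trans (tableOf-mapω d L (Pat.elements i)) (Pat.tableOf-elements i)

  -- The lower bound

  ruleColoring : Coloring (ω^ d) n (suc (P n d 1))
  ruleColoring = record { to = λ A → color A em ; cong = λ {A} {A′} A≈A′ → color-cong A A′ (≈-elements A≈A′) em em }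
    where
    -- The decision is a separate argument so that `color-cong` can compare two independent
    -- decisions for equal sets.
    color : ∀ A → Dec (∃[ i ] Realises A (table i)) → Fin (suc (P n d 1))
    color A (yes (i , _)) = suc i
    color A (no _)        = zero
    ≈-elements : ∀ {m} {xs ys : Vec (Ord d) m} → Pointwise.Pointwise (StrictTotalOrder._≈_ (ω^ d)) xs ys → xs ≡ ys
    ≈-elements Pointwise.[]            = refl
    ≈-elements (x≈y Pointwise.∷ xs≈ys) = cong₂ _∷_ (≈⇒≡ d x≈y) (≈-elements xs≈ys)
    color-cong : ∀ A A′ → elements A ≡ elements A′ → ∀ D D′ → color A D ≡ color A′ D′
    color-cong A@(finSubset _ _) (finSubset _ _) refl (yes (i , r)) (yes (i′ , r′)) =
      cong suc (table-injective i i′ (realises-unique A r r′))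
    color-cong (finSubset _ _) (finSubset _ _) refl (yes r) (no ¬r) = contradiction r ¬r
    color-cong (finSubset _ _) (finSubset _ _) refl (no ¬r) (yes r) = contradiction r ¬r
    color-cong (finSubset _ _) (finSubset _ _) refl (no _)  (no _)  = refl

  ruleColoring-realises : ∀ A i → Realises A (table i) → Func.to ruleColoring A ≡ suc i
  ruleColoring-realises A i r with em {∃[ i ] Realises A (table i)}
  ... | yes (i′ , r′) = cong suc (table-injective i′ i (realises-unique A r′ r))
  ... | no ¬r         = contradiction (i , r) ¬r

  lower : ∀ t → RamseyBound (ω^ d) n t → P n d 1 ≤ t
  lower t bounded with bounded (suc (P n d 1)) (s≤s z≤n) ruleColoring
  ... | S′ , _ , (f , iso) , C , colors , ∣C∣≤t = ≤-trans (sucs∈p⇒≤∣p∣ C used) ∣C∣≤t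
    where
    large : Large d S′
    large = embedding⇒large em d (proj₁ ∘ f) (λ _ _ → IsOrderIsomorphism.mono iso) (proj₂ ∘ f)
    used : ∀ i → suc i Subset.∈ C
    used i =
      let L , ∈S′ = embed-pattern d large (lookup (Pat.elements i)) (Arr.descending i) (Arr.coherent i)
                      -- Digits may equal `N`, and the stages must run strictly past all of them.
                      (suc N) (λ j k → s≤s (digit≤N i j k))
          A = mapSet L (patternSet i)
      in Equivalence.from (colors (suc i))
           ( A
           , all-∈ (λ y∈ → let x , x∈ , y≡ = ∈-map⁻ _ (elements (patternSet i)) y∈
                               j , x≡ = patternSet-∈ i x∈
                           in subst S′ (sym (trans y≡ (cong (mapω d (at L)) x≡))) (∈S′ j))
           , ruleColoring-realises A i (realises-mapSet L i))

  -- The upper bound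

  scale : Increasing
  -- Ranks may skip numbers, at which an increasing map still needs values; multiples of `suc N`
  -- leave room for these.
  scale = incr (suc N *_) (*-monoʳ-< (suc N))

  spread : Ord d → Ord d
  spread x = mapω d (at scale) (encode d 0 x)

  spread-coherent : ∀ x y → Coherent d (spread x) (spread y)
  spread-coherent x y = coherent-mapω d scale (encode-coherent d 0 x y)

  spread-descending : ∀ x → Descending d (spread x)
  spread-descending x = descending-mapω d scale (encode-descending d 0 x)

  digit-spread : ∀ x k → digit d (spread x) k ≡ suc N * suc (pred (digit d (encode d 0 x) k))
  digit-spread x k = trans (digit-mapω d (at scale) (encode d 0 x) k) (cong (suc N *_) (positive (encode> d 0 x k)))
    where
    positive : ∀ {m} → 0 < m → m ≡ suc (pred m)
    positive z<s = refl

  -- Such a vector is arranged, so its table belongs to a rule. The pattern of that rule has its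
  -- digits in the same order, and `interpolate` extends the correspondence of digits to an
  -- increasing map.
  spread-pattern : (e : Vec (Ord d) n) → (∀ {y} → y ∈ e → ∃[ x ] y ≡ spread x) → AllPairs (KeyLt d) e →
                   ∃[ i ] ∃[ L ] Vec.map (mapω d (at L)) (Pat.elements i) ≡ e
  spread-pattern e spread∋ e↗ = i , L , lookup-ext λ j → digit-injective d (digits j)
    where
    x : Fin n → Ord d
    x j = proj₁ (spread∋ (Vec∈.∈-lookup j e))
    e≡ : ∀ j → lookup e j ≡ spread (x j)
    e≡ j = proj₂ (spread∋ (Vec∈.∈-lookup j e))
    arr : Arranged d e
    arr = record
      { descending = λ j → subst (Descending d) (sym (e≡ j)) (spread-descending (x j))
      ; coherent   = λ j j′ → subst₂ (Coherent d) (sym (e≡ j)) (sym (e≡ j′)) (spread-coherent (x j) (x j′))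
      ; keys       = e↗
      }
    found : ∃[ i ] rule i ≡ (Vec.replicate n zero , tableOf d e)
    found = rule-complete _ (arranged⇒isCR d e arr (Vec.replicate n zero))
    i = proj₁ found
    tables≡ : tableOf d (Pat.elements i) ≡ tableOf d e
    tables≡ = trans (Pat.tableOf-elements i) (cong proj₂ (proj₂ found))
    interpolation : ∃[ L ] ∀ p → at L (value d (Pat.elements i) p) ≡ value d e p
    interpolation = interpolate em (value d (Pat.elements i)) (value d e)
      (λ (j , l) → pred (digit d (encode d 0 (x j)) (opposite l))) N
      (λ (j , l) → digit≤N i j (opposite l))
      (λ (j , l) → trans (cong (λ y → digit d y (opposite l)) (e≡ j)) (digit-spread (x j) (opposite l)))
      (λ p q le → entry⇒≤ d e p q (subst (λ R → T (entry R p q)) tables≡ (≤⇒entry d (Pat.elements i) p q le)))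
      (λ p q le → entry⇒≤ d (Pat.elements i) p q (subst (λ R → T (entry R p q)) (sym tables≡) (≤⇒entry d e p q le)))
    L = proj₁ interpolation
    digits : ∀ j k → digit d (lookup (Vec.map (mapω d (at L)) (Pat.elements i)) j) k ≡ digit d (lookup e j) k
    digits j k = subst (λ k → digit d (lookup (Vec.map (mapω d (at L)) (Pat.elements i)) j) k ≡ digit d (lookup e j) k)
      (Fin.opposite-involutive k)
      (trans (value-mapω d L (Pat.elements i) (j , opposite k)) (proj₂ interpolation (j , opposite k)))

  upper : RamseyBound (ω^ d) n (P n d 1)
  upper c _ COL =
      Image d F F-mono
    , (λ x≈y → subst (Image d F F-mono) (≈⇒≡ d x≈y))
    , image≈ d F F-mono
    , proj₁ used
    , (λ x → mk⇔ (proj₁ (proj₂ used x)) (proj₂ (proj₂ used x)))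
    , covered⇒∣p∣≤ (proj₁ ∘ homogeneous) λ {x} x∈C →
        let A , A⊆S′ , COL≡ = proj₁ (proj₂ used x) x∈C
            i , k≡ = ruled A A⊆S′
        in i , trans k≡ COL≡
    where
    COL-cong : ∀ A A′ → elements A ≡ elements A′ → Func.to COL A ≡ Func.to COL A′
    COL-cong A A′ eq = Func.cong COL {A} {A′}
      (subst (Pointwise.Pointwise (StrictTotalOrder._≈_ (ω^ d)) (elements A)) eq
        (Pointwise.refl (StrictTotalOrder.Eq.refl (ω^ d))))

    χ : Fin (P n d 1) → Increasing → Fin c
    χ i L = Func.to COL (mapSet L (patternSet i))

    -- Pattern digits are at most `N`, so only the values of `L` at 0, ..., `N` affect the set.
    χ-local : ∀ i → Local (suc N) (χ i)
    χ-local i L L′ agree = COL-cong (mapSet L (patternSet i)) (mapSet L′ (patternSet i))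
      (map-cong-∈ (elements (patternSet i)) λ {x} x∈ → digit-injective d λ k →
        let j , x≡ = patternSet-∈ i x∈ in
        trans (digit-mapω d (at L) x k) (trans
          (agree (digit d x k) (s≤s (subst (λ y → digit d y k ≤ N) (sym x≡) (digit≤N i j k))))
          (sym (digit-mapω d (at L′) x k))))

    h : Increasing
    h = proj₁ (ramsey* em (suc N) (P n d 1) χ χ-local)

    homogeneous : ∀ i → ∃[ k ] ∀ L → χ i (h ∘ᵢ L) ≡ k
    homogeneous = proj₂ (ramsey* em (suc N) (P n d 1) χ χ-local)

    F : Ord d → Ord d
    F x = mapω d (at h) (spread x)

    F-mono : ∀ {x y} → Lt d x y → Lt d (F x) (F y)
    F-mono x<y = mapω-mono d h (mapω-mono d scale (encode-mono d 0 x<y))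

    used = comprehension em λ x → ∃[ A ] (All (Image d F F-mono) (elements {ω^ d} {n} A) × Func.to COL A ≡ x)

    -- Undo `h`, list the resulting set by keys, and recognise it as `L` applied to a pattern. The
    -- given set is then that pattern under `h ∘ᵢ L`, whose color is fixed by homogeneity.
    ruled : ∀ A → All (Image d F F-mono) (elements A) → ∃[ i ] proj₁ (homogeneous i) ≡ Func.to COL A
    ruled A@(finSubset ys ys↗) ys⊆S′ =
      let e , e↗ , es~e = sort (byKey d) es es-distinct
          i , L , pattern≡e = spread-pattern e (λ y∈e → es∋ (proj₂ es~e y∈e)) e↗
      in i , trans (sym (proj₂ (homogeneous i) L)) (COL-cong (mapSet (h ∘ᵢ L) (patternSet i)) A
           (sorted-unique (ω^ d) (FinSubset.increasing (mapSet (h ∘ᵢ L) (patternSet i))) ys↗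
             (sameMembers-trans (sameMembers-map _ (sameMembers-sym (pattern~ i)))
               (subst₂ SameMembers
                 (trans (cong (Vec.map (mapω d (at h))) (sym pattern≡e)) (map-∘ L (Pat.elements i)))
                 map-es
                 (sameMembers-map (mapω d (at h)) (sameMembers-sym es~e))))))
      where
      map-∘ : ∀ L (xs : Vec (Ord d) n) →
              Vec.map (mapω d (at h)) (Vec.map (mapω d (at L)) xs) ≡ Vec.map (mapω d (at (h ∘ᵢ L))) xs
      map-∘ L xs = trans (sym (Vec.map-∘ _ _ xs)) (Vec.map-cong (mapω-∘ d (at h) (at L)) xs)
      x : Fin n → Ord d
      x j = proj₁ (All.lookup⁺ {P = Image d F F-mono} ys⊆S′ j)
      Fx≡ : ∀ j → F (x j) ≡ lookup ys j
      Fx≡ j = proj₂ (All.lookup⁺ {P = Image d F F-mono} ys⊆S′ j)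
      es : Vec (Ord d) n
      es = tabulate (spread ∘ x)
      map-es : Vec.map (mapω d (at h)) es ≡ ys
      map-es = lookup-ext λ j → trans (Vec.lookup-map j _ es)
        (trans (cong (mapω d (at h)) (Vec.lookup∘tabulate (spread ∘ x) j)) (Fx≡ j))
      -- Equal keys would, by coherence, make two members of the strictly increasing `ys` equal.
      es-distinct : AllPairs (λ y z → ¬ (key d y ≡ key d z)) es
      es-distinct = allPairs-tabulate (spread ∘ x) λ j j′ j<j′ eq → Lt-irrefl d
        (subst₂ (Lt d) (sym (Fx≡ j)) (trans (sym (Fx≡ j′)) (cong (mapω d (at h))
            (sym (coherent-key d (spread-coherent (x j) (x j′)) eq))))
          (allPairs-lookup ys↗ j j′ j<j′))
      es∋ : ∀ {y} → y ∈ es → ∃[ x ] y ≡ spread x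
      es∋ y∈es = x (Any.index y∈es) , trans (Any.lookup-index y∈es) (Vec.lookup∘tabulate (spread ∘ x) (Any.index y∈es))

theorem8p4 : ExcludedMiddle 0ℓ → (n d : ℕ) →
    ((τ : ℕ∞) → T[ n , ω^ d ]≔ τ → [ P n d 1 ] ≤∞ τ) ×
    T[ n , ω^ d ]≔ [ P n d 1 ]
theorem8p4 em n d =
    (λ { [ t ] (bounded , _) → Supremum.[ lower em n d t bounded ] ; ⊤⁺ _ → [ P n d 1 ] Supremum.≤⊤⁺ })
  , upper em n d , lower em n d
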